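{- Let $r\ge 13$ be a natural number. Then (a) $F_v(2_r;r-10)\ge r+21$, and $F_v(2_r;r-10)=r+21$ if $R(10,3)>41$ and $r\ge 20$; (b) if $R(10,3)\le 41$, then $F_v(2_r;r-10)\ge r+22$, and $F_v(2_r;r-10)=r+22$ if $r\ge 21$.
   Context: All graphs are finite, simple and undirected; $\omega(G)$ denotes the clique number and $\alpha(G)$ the independence number. The Ramsey number $R(p,3)$ is the smallest $n$ such that every graph on at least $n$ vertices satisfies $\omega(G)\ge p$ or $\alpha(G)\ge 3$. For positive integers $a_1,\dots,a_r$, $G\overset{v}{\to}(a_1,\dots,a_r)$ means that for every partition $V(G)=V_1\cup\dots\cup V_r$ into pairwise disjoint (possibly empty) sets some $V_i$ contains an $a_i$-clique. $(2_r)$ denotes the sequence of $r$ twos. $H_v(a_1,\dots,a_r;q)$ is the set of graphs $G$ with $G\overset{v}{\to}(a_1,\dots,a_r)$ and $\omega(G)<q$, and $F_v(a_1,\dots,a_r;q)=\min\{|V(G)|:G\in H_v(a_1,\dots,a_r;q)\}$. Equivalently, $F_v(2_r;q)$ is the minimum number of vertices of a graph with chromatic number at least $r+1$ and clique number less than $q$. -}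

module Defs where

open import Data.Nat using (ℕ; _≤_)
open import Data.Fin using (Fin)
open import Data.Bool using (Bool; true; false)
open import Data.Sum using (_⊎_)
open import Data.Product using (Σ; _×_; ∃; ∃-syntax)
open import Relation.Nullary using (¬_)
open import Relation.Binary.PropositionalEquality using (_≡_; _≢_)
open import Function.Definitions using (Injective)

record Graph (n : ℕ) : Set where
  field
    adj    : Fin n → Fin n → Bool
    adj-sym    : ∀ i j → adj i j ≡ adj j i
    adj-irrefl : ∀ i → adj i i ≡ false
open Graph public

IsClique : ∀ {n k} → Graph n → (Fin k → Fin n) → Set
IsClique {k = k} G f =
  Injective _≡_ _≡_ f × (∀ (i j : Fin k) → i ≢ j → adj G (f i) (f j) ≡ true)

IsIndep : ∀ {n k} → Graph n → (Fin k → Fin n) → Set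
IsIndep {k = k} G f =
  Injective _≡_ _≡_ f × (∀ (i j : Fin k) → i ≢ j → adj G (f i) (f j) ≡ false)

HasClique : ∀ {n} → Graph n → ℕ → Set
HasClique {n} G k = Σ (Fin k → Fin n) (IsClique G)

HasIndep : ∀ {n} → Graph n → ℕ → Set
HasIndep {n} G k = Σ (Fin k → Fin n) (IsIndep G)

-- "R(p,3) ≤ m": every graph on at least m vertices has ω ≥ p or α ≥ 3.
-- (Since R(p,3) is the least such m and the property is upward closed
--  by definition, R(p,3) ≤ m iff m has the property.)
RamseyLe : ℕ → ℕ → Set
RamseyLe p m = ∀ (n : ℕ) → m ≤ n → (G : Graph n) → HasClique G p ⊎ HasIndep G 3

-- G →ᵛ (a₁,…,a_r): for every partition V = V₁ ∪ … ∪ V_r (given as a colouring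
-- c : V → Fin r, parts possibly empty) some V_i contains an a_i-clique.
VArrows : ∀ {n} → Graph n → (r : ℕ) → (Fin r → ℕ) → Set
VArrows {n} G r a =
  ∀ (c : Fin n → Fin r) →
    ∃[ i ] Σ (Fin (a i) → Fin n) λ f → IsClique G f × (∀ x → c (f x) ≡ i)

InHv : ∀ {n} → Graph n → (r : ℕ) → (Fin r → ℕ) → ℕ → Set
InHv G r a q = VArrows G r a × ¬ HasClique G q

twos : (r : ℕ) → Fin r → ℕ
twos r _ = 2

FvGe : (r : ℕ) → (Fin r → ℕ) → ℕ → ℕ → Set
FvGe r a q m = ∀ (n : ℕ) (G : Graph n) → InHv G r a q → m ≤ n

FvEq : (r : ℕ) → (Fin r → ℕ) → ℕ → ℕ → Set
FvEq r a q m = FvGe r a q m × Σ (Graph m) λ G → InHv G r a q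

{-# OPTIONS --safe #-}
-- Let χ(G) ≥ r + 1 and ω(G) < r − 10, and write m = n − χ(G).  The lower bounds say that χ − ω ≥ 12 forces
-- m ≥ 20, and m ≥ 21 if R(10,3) ≤ 41.  Deleting an independent triple lowers m by at least 2 and χ − ω by at
-- most 1, so the core case is α(G) ≤ 2.  Then the complement H is triangle-free, colourings of G are matchings
-- of H, m is the matching number and χ − ω = n − m − α(H).  A vertex of H missed by no maximum matching can be
-- deleted.  If every vertex is missed by some maximum matching, "x = y or no maximum matching misses both x and
-- y" is an equivalence relation whose classes are unions of components (Gallai, Lovász): with two classes H
-- splits and the bound is superadditive, with one class n = 2m + 1 and Ramsey bounds for R(k,3) apply.  The
-- bounds R(k,3) ≤ 3, 6, 9, 14, 19, 24, 30, 37 (k = 2, …, 9) come from averaging lower bounds on the number of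
-- edges over the non-neighbourhoods of the vertices (Graver, Yackel).
--
-- For the upper bounds, a graph with α ≤ 2 and more than 2r vertices is not r-colourable: take a Ramsey graph on
-- 41 vertices, respectively the complement of the circulant graph C₄₃(10,14,16,18,21), and add universal vertices.
module Submission where

open import Defs
open import Data.Bool using (Bool; true; false; _∧_; _∨_; not; if_then_else_; T) renaming (_≟_ to _≟ᴮ_)
open import Data.Bool.ListAction using (any)
open import Data.Bool.Properties using (T-≡; ¬-not; not-injective; ∨-comm; ∨-idem)
open import Data.Empty using (⊥; ⊥-elim)
open import Data.Fin using (Fin; zero; suc; toℕ; fromℕ<; inject≤; punchIn; punchOut)
open import Data.Fin.Permutation using (permutation)
open import Data.Fin.Properties using (_≟_; suc-injective; any?; all?; toℕ-fromℕ<; inject≤-injective;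
  punchIn-punchOut; punchIn-injective; punchInᵢ≢i; punchOut-injective) renaming (<-cmp to <ᶠ-cmp)
open import Data.List using (List; []; _∷_; _++_; length; map; lookup; tabulate; upTo; applyUpTo; filterᵇ)
open import Data.List.Membership.Propositional.Properties using (∈-lookup)
open import Data.List.Properties using (length-map; length-++; length-tabulate)
open import Data.List.Relation.Unary.All as All using (All; []; _∷_)
import Data.List.Relation.Unary.All.Properties as All
open import Data.List.Relation.Unary.AllPairs as AllPairs using (AllPairs; []; _∷_)
import Data.List.Relation.Unary.AllPairs.Properties as AllPairs
open import Data.Nat using (ℕ; zero; suc; z≤n; s≤s; z<s; _+_; _*_; _∸_; _/_; _≤_; _<_; _⊓_; _⊔′_; _⊓′_;
  _≡ᵇ_; _<ᵇ_; _≤ᵇ_)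
open import Data.Nat.DivMod using (m<n*o⇒m/o<n)
open import Data.Nat.Properties hiding (suc-injective) renaming (_≟_ to _≟ᴺ_)
open import Data.Nat.Tactic.RingSolver using (solve-∀)
open import Data.Product using (Σ; ∃; ∃-syntax; _×_; _,_; proj₁; proj₂)
open import Data.Sum using (_⊎_; inj₁; inj₂)
open import Data.Unit using (tt)
open import Data.Vec using (Vec; []; _∷_) renaming (lookup to lookupⱽ; tabulate to tabulateⱽ)
open import Data.Vec.Properties using (lookup∘tabulate)
open import Function using (_∘_; id)
open import Function.Bundles using (module Equivalence)
open import Function.Definitions using (Injective)
open import Relation.Binary.Definitions using (tri<; tri≈; tri>)
open import Relation.Binary.PropositionalEquality
open import Relation.Nullary using (¬_; Dec; yes; no; does; proof; contradiction)
open import Relation.Nullary.Decidable using (from-yes; map′; dec-true; decidable-stable;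
  ¬¬-excluded-middle; ¬?; _×-dec_; _⊎-dec_; _→-dec_)
open import Relation.Nullary.Reflects using (Reflects; invert)
open import Algebra.Properties.Semiring.Sum +-*-semiring using (sum; sum-cong-≗; sum-permute; ∑-distrib-+;
  ∑-comm; *-distribˡ-sum; *-distribʳ-sum)

private variable
  n N : ℕ

-- Subsets of a finite set and their cardinalities

⟦_⟧ : Bool → ℕ
⟦ true ⟧  = 1
⟦ false ⟧ = 0

Sub : ℕ → Set
Sub N = Fin N → Bool

infix 4 _∈_ _⊑_ _==_

_∈_ : ∀ {N} → Fin N → Sub N → Set
x ∈ S = S x ≡ true

_⊑_ : ∀ {N} → Sub N → Sub N → Set
S ⊑ T = ∀ x → x ∈ S → x ∈ T

_==_ : ∀ {N} → Fin N → Fin N → Bool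
x == y = does (x ≟ y)

==-refl : ∀ {N} (x : Fin N) → (x == x) ≡ true
==-refl x with x ≟ x
... | yes _  = refl
... | no x≢x = contradiction refl x≢x

≡⇒== : ∀ {N} {x y : Fin N} → x ≡ y → (x == y) ≡ true
≡⇒== {x = x} refl = ==-refl x

==⇒≡ : ∀ {N} {x y : Fin N} → (x == y) ≡ true → x ≡ y
==⇒≡ {x = x} {y} e with x ≟ y
... | yes p = p

≢⇒==-false : ∀ {N} {x y : Fin N} → x ≢ y → (x == y) ≡ false
≢⇒==-false {x = x} {y} x≢y with x ≟ y
... | yes p = contradiction p x≢y
... | no _  = refl

∧-true : ∀ {a b} → a ∧ b ≡ true → a ≡ true × b ≡ true
∧-true {true} {true} _ = refl , refl

true≢false : ∀ {b} → b ≡ true → b ≡ false → ⊥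
true≢false refl ()

count : ∀ {N} → Sub N → ℕ
count S = sum (λ x → ⟦ S x ⟧)

sum-mono : ∀ {n} {f g : Fin n → ℕ} → (∀ i → f i ≤ g i) → sum f ≤ sum g
sum-mono {zero}  f≤g = z≤n
sum-mono {suc n} f≤g = +-mono-≤ (f≤g zero) (sum-mono (f≤g ∘ suc))

sum-const : ∀ n c → sum {n} (λ _ → c) ≡ n * c
sum-const zero    c = refl
sum-const (suc n) c = cong (c +_) (sum-const n c)

sum-zero : ∀ n → sum {n} (λ _ → 0) ≡ 0
sum-zero n = trans (sum-const n 0) (*-zeroʳ n)

sum-+₃ : ∀ {n} (f g h : Fin n → ℕ) → sum (λ x → f x + g x + h x) ≡ sum f + sum g + sum h
sum-+₃ f g h = trans (∑-distrib-+ (λ x → f x + g x) h) (cong (_+ sum h) (∑-distrib-+ f g))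

count-singleton : ∀ {N} (x : Fin N) → sum (λ w → ⟦ w == x ⟧) ≡ 1
count-singleton {suc N} zero    = cong suc (sum-zero N)
count-singleton {suc N} (suc x) = trans (sum-cong-≗ pointwise) (count-singleton x)
  where
  pointwise : ∀ w → ⟦ suc w == suc x ⟧ ≡ ⟦ w == x ⟧
  pointwise w with w ≟ x
  ... | yes _ = refl
  ... | no _  = refl

count-full : ∀ N → count {N} (λ _ → true) ≡ N
count-full N = trans (sum-const N 1) (*-identityʳ N)

_∖_ : ∀ {N} → Sub N → Fin N → Sub N
(S ∖ v) x = S x ∧ not (x == v)

∖-⊑ : ∀ {N} (S : Sub N) v → (S ∖ v) ⊑ S
∖-⊑ S v x = proj₁ ∘ ∧-true

∖-∉ : ∀ {N} (S : Sub N) v → (S ∖ v) v ≡ true → ⊥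
∖-∉ S v p with ∧-true {S v} p
... | _ , q rewrite ==-refl v = contradiction q λ ()

∈-∖ : ∀ {N} (S : Sub N) {x v} → x ∈ S → x ≢ v → x ∈ (S ∖ v)
∈-∖ S x∈S x≢v rewrite x∈S | ≢⇒==-false x≢v = refl

count-∖ : ∀ {N} (S : Sub N) {v} → v ∈ S → count S ≡ suc (count (S ∖ v))
count-∖ S {v} v∈S = begin
  count S                                     ≡⟨ sum-cong-≗ pointwise ⟩
  sum (λ x → ⟦ x == v ⟧ + ⟦ (S ∖ v) x ⟧)      ≡⟨ ∑-distrib-+ (λ x → ⟦ x == v ⟧) (λ x → ⟦ (S ∖ v) x ⟧) ⟩
  sum (λ x → ⟦ x == v ⟧) + count (S ∖ v)      ≡⟨ cong (_+ count (S ∖ v)) (count-singleton v) ⟩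
  suc (count (S ∖ v))                         ∎
  where
  open ≡-Reasoning
  pointwise : ∀ x → ⟦ S x ⟧ ≡ ⟦ x == v ⟧ + ⟦ (S ∖ v) x ⟧
  pointwise x with x ≟ v
  ... | yes refl rewrite v∈S = refl
  ... | no _ with S x
  ...   | true  = refl
  ...   | false = refl

count-positive : ∀ {N} (S : Sub N) → 0 < count S → ∃[ x ] x ∈ S
count-positive {suc N} S 0<c with S zero in eq
... | true  = zero , eq
... | false with count-positive (S ∘ suc) 0<c
...   | x , x∈S = suc x , x∈S

elements : ∀ {N} (S : Sub N) → ∃[ l ] length l ≡ count S × All (_∈ S) l × AllPairs _≢_ l
elements {zero}  S = [] , refl , [] , []
elements {suc N} S with elements (S ∘ suc) | S zero in eq
... | l , len , l∈S , l≢ | false = map suc l , trans (length-map suc l) len ,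
        All.map⁺ l∈S , AllPairs.map⁺ (AllPairs.map (λ x≢y → x≢y ∘ suc-injective) l≢)
... | l , len , l∈S , l≢ | true = zero ∷ map suc l , cong suc (trans (length-map suc l) len) ,
        eq ∷ All.map⁺ l∈S ,
        All.map⁺ (All.universal (λ _ ()) l) ∷ AllPairs.map⁺ (AllPairs.map (λ x≢y → x≢y ∘ suc-injective) l≢)

-- A member is numbered by how many members come after it. The numbers serve as colours, one for
-- each element of `R`.
rank : ∀ {N} (R : Sub N) → Σ (Fin N → ℕ) λ f →
  (∀ x → x ∈ R → f x < count R) × (∀ x y → x ∈ R → y ∈ R → f x ≡ f y → x ≡ y)
rank {zero}  R = (λ _ → 0) , (λ ()) , (λ ())
rank {suc N} R with rank (R ∘ suc)
... | f , f< , inj = g , g< , g-inj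
  where
  g : Fin (suc N) → ℕ
  g zero    = count (R ∘ suc)
  g (suc x) = f x
  g< : ∀ x → x ∈ R → g x < count R
  g< zero    p rewrite p = ≤-refl
  g< (suc x) p = ≤-trans (f< x p) (m≤n+m (count (R ∘ suc)) ⟦ R zero ⟧)
  g-inj : ∀ x y → x ∈ R → y ∈ R → g x ≡ g y → x ≡ y
  g-inj zero    zero    _ _ _ = refl
  g-inj zero    (suc y) _ q e = contradiction (sym e) (<⇒≢ (f< y q))
  g-inj (suc x) zero    p _ e = contradiction e (<⇒≢ (f< x p))
  g-inj (suc x) (suc y) p q e = cong suc (inj x y p q e)

-- Counting edges of triangle-free graphs

⟦∧⟧ : ∀ a b → ⟦ a ∧ b ⟧ ≡ ⟦ a ⟧ * ⟦ b ⟧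
⟦∧⟧ true  b = sym (*-identityˡ ⟦ b ⟧)
⟦∧⟧ false b = refl

module Edges {N : ℕ} (h : Fin N → Fin N → Bool)
  (h-sym : ∀ x y → h x y ≡ h y x) (h-irrefl : ∀ x → h x x ≡ false) where

  TriangleFree : Sub N → Set
  TriangleFree S = ∀ x y z → x ∈ S → y ∈ S → z ∈ S →
    h x y ≡ true → h y z ≡ true → h x z ≡ true → ⊥

  Independent : Sub N → List (Fin N) → Set
  Independent S l = All (_∈ S) l × AllPairs (λ x y → x ≢ y × h x y ≡ false) l

  AllIndependent< : Sub N → ℕ → Set
  AllIndependent< S k = ∀ l → Independent S l → length l < k

  neighbours nonNeighbours : Sub N → Fin N → Sub N
  neighbours S v x = S x ∧ h v x
  nonNeighbours S v x = S x ∧ not (x == v) ∧ not (h v x)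

  degree : Sub N → Fin N → ℕ
  degree S v = count (neighbours S v)

  -- Twice the number of edges inside S.
  volume : Sub N → ℕ
  volume S = sum (λ x → sum (λ y → ⟦ S x ∧ S y ∧ h x y ⟧))

  weightedDegrees : (R S : Sub N) →
    sum (λ x → sum (λ y → ⟦ R x ∧ (S y ∧ h x y) ⟧)) ≡ sum (λ x → ⟦ R x ⟧ * degree S x)
  weightedDegrees R S = sum-cong-≗ (λ x → trans (sum-cong-≗ (λ y → ⟦∧⟧ (R x) (S y ∧ h x y)))
    (sym (*-distribˡ-sum ⟦ R x ⟧ (λ y → ⟦ S y ∧ h x y ⟧))))

  TriangleFree-⊑ : ∀ {S T} → S ⊑ T → TriangleFree T → TriangleFree S
  TriangleFree-⊑ S⊑T tf x y z x∈ y∈ z∈ = tf x y z (S⊑T x x∈) (S⊑T y y∈) (S⊑T z z∈)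

  Independent-⊑ : ∀ {S T l} → S ⊑ T → Independent S l → Independent T l
  Independent-⊑ S⊑T (l∈S , l-ind) = All.map (S⊑T _) l∈S , l-ind

  nonNeighbours-⊑ : ∀ S v → nonNeighbours S v ⊑ S
  nonNeighbours-⊑ S v x = proj₁ ∘ ∧-true

  Independent-∷ : ∀ {S v l} → v ∈ S → Independent (nonNeighbours S v) l → Independent S (v ∷ l)
  Independent-∷ {S} {v} v∈S ind@(l∈ , l-ind) =
    v∈S ∷ proj₁ (Independent-⊑ (nonNeighbours-⊑ S v) ind) , All.map apart l∈ ∷ l-ind
    where
    apart : ∀ {x} → x ∈ nonNeighbours S v → v ≢ x × h v x ≡ false
    apart {x} p with ∧-true {S x} p
    ... | _ , q with x ≟ v | h v x
    ...   | no x≢v | false = x≢v ∘ sym , refl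

  nonNeighbours-Independent< : ∀ {S v k} → v ∈ S → AllIndependent< S (suc k) →
    AllIndependent< (nonNeighbours S v) k
  nonNeighbours-Independent< v∈S small l ind = ≤-pred (small (_ ∷ l) (Independent-∷ v∈S ind))

  -- Two adjacent neighbours of `v` would close a triangle, so the neighbours of `v` form an
  -- independent set.
  degree≤ : ∀ {S v k} → TriangleFree S → v ∈ S → AllIndependent< S (suc k) → degree S v ≤ k
  degree≤ {S} {v} tf v∈S small with elements (neighbours S v)
  ... | l , len , l∈ , l≢ = subst (_≤ _) len
      (≤-pred (small l (All.map (proj₁ ∘ ∧-true) l∈ , independent l l∈ l≢)))
    where
    nonadjacent : ∀ {x y} → x ∈ neighbours S v → y ∈ neighbours S v → h x y ≡ false
    nonadjacent {x} {y} p q with ∧-true {S x} p | ∧-true {S y} q | h x y in eq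
    ... | x∈S , vx | y∈S , vy | true  = ⊥-elim (tf v x y v∈S x∈S y∈S vx eq vy)
    ... | _        | _        | false = refl
    independent : ∀ l → All (_∈ neighbours S v) l → AllPairs _≢_ l →
      AllPairs (λ x y → x ≢ y × h x y ≡ false) l
    independent []      _         _         = []
    independent (x ∷ l) (x∈ ∷ l∈) (x≢ ∷ l≢) =
      All.zipWith (λ (x≢y , y∈) → x≢y , nonadjacent x∈ y∈) (x≢ , l∈) ∷ independent l l∈ l≢

  count-split : ∀ S {v} → v ∈ S → count S ≡ suc (degree S v + count (nonNeighbours S v))
  count-split S {v} v∈S = begin
    count S
      ≡⟨ sum-cong-≗ pointwise ⟩
    sum (λ x → ⟦ x == v ⟧ + ⟦ neighbours S v x ⟧ + ⟦ nonNeighbours S v x ⟧)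
      ≡⟨ sum-+₃ (λ x → ⟦ x == v ⟧) (λ x → ⟦ neighbours S v x ⟧) (λ x → ⟦ nonNeighbours S v x ⟧) ⟩
    sum (λ x → ⟦ x == v ⟧) + degree S v + count (nonNeighbours S v)
      ≡⟨ cong (λ c → c + degree S v + count (nonNeighbours S v)) (count-singleton v) ⟩
    suc (degree S v + count (nonNeighbours S v)) ∎
    where
    open ≡-Reasoning
    pointwise : ∀ x → ⟦ S x ⟧ ≡ ⟦ x == v ⟧ + ⟦ neighbours S v x ⟧ + ⟦ nonNeighbours S v x ⟧
    pointwise x with x ≟ v
    ... | yes refl rewrite v∈S | h-irrefl v = refl
    ... | no _ with S x | h v x
    ...   | true  | true  = refl
    ...   | true  | false = refl
    ...   | false | true  = refl
    ...   | false | false = refl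

  -- An edge that does not lie inside the non-neighbourhood of `v` has exactly one end among the
  -- neighbours of `v`: these are pairwise non-adjacent, and the edges at `v` end there. Summing
  -- degrees over the neighbours therefore counts each such edge once, while `volume` counts it
  -- twice.
  volume-split : ∀ S {v} → TriangleFree S → v ∈ S →
    volume S ≡ volume (nonNeighbours S v) + 2 * sum (λ w → ⟦ neighbours S v w ⟧ * degree S w)
  volume-split S {v} tf v∈S = begin
    volume S
      ≡⟨ sum-cong-≗ (λ x → sum-cong-≗ (λ y → pointwise x y)) ⟩
    sum (λ x → sum (λ y → a x y + b x y + b y x))
      ≡⟨ sum-cong-≗ (λ x → sum-+₃ (a x) (b x) (λ y → b y x)) ⟩
    sum (λ x → sum (a x) + sum (b x) + sum (λ y → b y x))
      ≡⟨ sum-+₃ (λ x → sum (a x)) (λ x → sum (b x)) (λ x → sum (λ y → b y x)) ⟩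
    volume R + sum (λ x → sum (b x)) + sum (λ x → sum (λ y → b y x))
      ≡⟨ cong₂ (λ s t → volume R + s + t) (weightedDegrees Q S)
           (trans (∑-comm (λ x y → b y x)) (weightedDegrees Q S)) ⟩
    volume R + D + D
      ≡⟨ double (volume R) D ⟩
    volume R + 2 * D ∎
    where
    open ≡-Reasoning
    Q R : Sub N
    Q = neighbours S v
    R = nonNeighbours S v
    D = sum (λ w → ⟦ Q w ⟧ * degree S w)
    a b : Fin N → Fin N → ℕ
    a x y = ⟦ R x ∧ R y ∧ h x y ⟧
    b x y = ⟦ Q x ∧ (S y ∧ h x y) ⟧
    double : ∀ r d → r + d + d ≡ r + 2 * d
    double = solve-∀
    pointwise : ∀ x y → ⟦ S x ∧ S y ∧ h x y ⟧ ≡ a x y + b x y + b y x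
    pointwise x y rewrite h-sym y x with S x in x∈ | S y in y∈
    ... | false | false = refl
    ... | false | true with h v y
    ...   | true  = refl
    ...   | false = refl
    pointwise x y | true | false with x ≟ v | h v x
    ...   | yes _ | true  = refl
    ...   | yes _ | false = refl
    ...   | no _  | true  = refl
    ...   | no _  | false = refl
    pointwise x y | true | true with x ≟ v | y ≟ v
    ...   | yes refl | yes refl rewrite h-irrefl v = refl
    ...   | yes refl | no _     rewrite h-irrefl v with h v y
    ...     | true  = refl
    ...     | false = refl
    pointwise x y | true | true | no _ | yes refl rewrite h-irrefl v | h-sym x v with h v x
    ...     | true  = refl
    ...     | false = refl
    pointwise x y | true | true | no _ | no _ with h v x in vx | h v y in vy | h x y in xy
    ...     | true  | true  | true  = ⊥-elim (tf v x y v∈S x∈ y∈ vx xy vy)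
    ...     | true  | true  | false = refl
    ...     | true  | false | true  = refl
    ...     | true  | false | false = refl
    ...     | false | true  | true  = refl
    ...     | false | true  | false = refl
    ...     | false | false | true  = refl
    ...     | false | false | false = refl

  volume-degrees : ∀ S → volume S ≡ sum (λ v → ⟦ S v ⟧ * degree S v)
  volume-degrees S = weightedDegrees S S

  -- Sum `volume-split` over `v` in `S`. In the resulting double sum a vertex `w` occurs once for
  -- each of its own neighbours, so it contributes the square of its degree; this exchange is `∑B`.
  volume-average : ∀ S → TriangleFree S → count S * volume S ≡
    sum (λ v → ⟦ S v ⟧ * (volume (nonNeighbours S v) + 2 * (degree S v * degree S v)))
  volume-average S tf = begin
    count S * volume S
      ≡⟨ *-distribʳ-sum (volume S) (λ v → ⟦ S v ⟧) ⟩
    sum (λ v → ⟦ S v ⟧ * volume S)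
      ≡⟨ sum-cong-≗ pointwise ⟩
    sum (λ v → A v + 2 * B v)
      ≡⟨ ∑-distrib-+ A (λ v → 2 * B v) ⟩
    sum A + sum (λ v → 2 * B v)
      ≡⟨ cong (sum A +_) (trans (sym (*-distribˡ-sum 2 B)) (trans (cong (2 *_) ∑B) (*-distribˡ-sum 2 C))) ⟩
    sum A + sum (λ v → 2 * C v)
      ≡⟨ sym (∑-distrib-+ A (λ v → 2 * C v)) ⟩
    sum (λ v → A v + 2 * C v)
      ≡⟨ sum-cong-≗ (λ v → regroup ⟦ S v ⟧ (volume (nonNeighbours S v)) (degree S v)) ⟩
    sum (λ v → ⟦ S v ⟧ * (volume (nonNeighbours S v) + 2 * (degree S v * degree S v))) ∎
    where
    open ≡-Reasoning
    A B C : Fin N → ℕ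
    A v = ⟦ S v ⟧ * volume (nonNeighbours S v)
    B v = ⟦ S v ⟧ * sum (λ w → ⟦ neighbours S v w ⟧ * degree S w)
    C v = ⟦ S v ⟧ * degree S v * degree S v
    regroup : ∀ s a d → s * a + 2 * (s * d * d) ≡ s * (a + 2 * (d * d))
    regroup = solve-∀
    pointwise : ∀ v → ⟦ S v ⟧ * volume S ≡ A v + 2 * B v
    pointwise v with S v in v∈S
    ... | false = refl
    ... | true = begin
      1 * volume S  ≡⟨ cong (1 *_) (volume-split S tf v∈S) ⟩
      1 * (a + 2 * b) ≡⟨ unit a b ⟩
      1 * a + 2 * (1 * b) ∎
      where
      a = volume (nonNeighbours S v)
      b = sum (λ w → ⟦ neighbours S v w ⟧ * degree S w)
      unit : ∀ a b → 1 * (a + 2 * b) ≡ 1 * a + 2 * (1 * b)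
      unit = solve-∀
    swap : ∀ v w → ⟦ S v ⟧ * (⟦ neighbours S v w ⟧ * degree S w) ≡ ⟦ S w ⟧ * degree S w * ⟦ neighbours S w v ⟧
    swap v w rewrite ⟦∧⟧ (S w) (h v w) | ⟦∧⟧ (S v) (h w v) | h-sym w v =
      rearrange ⟦ S v ⟧ ⟦ S w ⟧ ⟦ h v w ⟧ (degree S w)
      where
      rearrange : ∀ s t e d → s * (t * e * d) ≡ t * d * (s * e)
      rearrange = solve-∀
    ∑B : sum B ≡ sum C
    ∑B = begin
      sum B
        ≡⟨ sum-cong-≗ (λ v → *-distribˡ-sum ⟦ S v ⟧ (λ w → ⟦ neighbours S v w ⟧ * degree S w)) ⟩
      sum (λ v → sum (λ w → ⟦ S v ⟧ * (⟦ neighbours S v w ⟧ * degree S w)))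
        ≡⟨ sum-cong-≗ (λ v → sum-cong-≗ (swap v)) ⟩
      sum (λ v → sum (λ w → ⟦ S w ⟧ * degree S w * ⟦ neighbours S w v ⟧))
        ≡⟨ ∑-comm (λ v w → ⟦ S w ⟧ * degree S w * ⟦ neighbours S w v ⟧) ⟩
      sum (λ w → sum (λ v → ⟦ S w ⟧ * degree S w * ⟦ neighbours S w v ⟧))
        ≡⟨ sum-cong-≗ (λ w → sym (*-distribˡ-sum (⟦ S w ⟧ * degree S w) (λ v → ⟦ neighbours S w v ⟧))) ⟩
      sum C ∎

  VolumeBound : ℕ → (ℕ → ℕ) → Set
  VolumeBound k E = ∀ S → TriangleFree S → AllIndependent< S k → E (count S) ≤ volume S

  -- In `volume-average` the non-neighbourhood of a vertex of degree `d` has `count S ∸ suc d`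
  -- vertices and no independent `k`-set, so `E` applies to it. After passing to the linear minorant
  -- `a * d + b` only the sum of the degrees remains, and that is `volume S`.
  volume-certificate : ∀ k E a b S → VolumeBound k E → TriangleFree S → AllIndependent< S (suc k) →
    (∀ d → d ≤ k → a * d + b ≤ E (count S ∸ suc d) + 2 * (d * d)) →
    a * volume S + count S * b ≤ count S * volume S
  volume-certificate k E a b S bound tf small line = begin
    a * volume S + count S * b
      ≡⟨ cong₂ _+_ (cong (a *_) (volume-degrees S)) (*-distribʳ-sum b (λ v → ⟦ S v ⟧)) ⟩
    a * sum (λ v → ⟦ S v ⟧ * degree S v) + sum (λ v → ⟦ S v ⟧ * b)
      ≡⟨ cong (_+ sum (λ v → ⟦ S v ⟧ * b)) (*-distribˡ-sum a (λ v → ⟦ S v ⟧ * degree S v)) ⟩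
    sum (λ v → a * (⟦ S v ⟧ * degree S v)) + sum (λ v → ⟦ S v ⟧ * b)
      ≡⟨ sym (∑-distrib-+ (λ v → a * (⟦ S v ⟧ * degree S v)) (λ v → ⟦ S v ⟧ * b)) ⟩
    sum (λ v → a * (⟦ S v ⟧ * degree S v) + ⟦ S v ⟧ * b)
      ≤⟨ sum-mono pointwise ⟩
    sum (λ v → ⟦ S v ⟧ * (volume (nonNeighbours S v) + 2 * (degree S v * degree S v)))
      ≡⟨ sym (volume-average S tf) ⟩
    count S * volume S ∎
    where
    open ≤-Reasoning
    factor : ∀ s a d b → a * (s * d) + s * b ≡ s * (a * d + b)
    factor = solve-∀
    pointwise : ∀ v → a * (⟦ S v ⟧ * degree S v) + ⟦ S v ⟧ * b ≤
      ⟦ S v ⟧ * (volume (nonNeighbours S v) + 2 * (degree S v * degree S v))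
    pointwise v rewrite factor ⟦ S v ⟧ a (degree S v) b with S v in v∈S
    ... | false = z≤n
    ... | true = *-monoʳ-≤ 1 (≤-trans (line (degree S v) (degree≤ tf v∈S small))
        (+-monoˡ-≤ _ (subst (λ n → E n ≤ volume R) rest
          (bound R (TriangleFree-⊑ (nonNeighbours-⊑ S v) tf) (nonNeighbours-Independent< v∈S small)))))
      where
      R = nonNeighbours S v
      rest : count R ≡ count S ∸ suc (degree S v)
      rest = trans (sym (m+n∸m≡n (degree S v) (count R))) (cong (_∸ suc (degree S v)) (sym (count-split S v∈S)))

  volume≤ : ∀ {k} S → TriangleFree S → AllIndependent< S (suc k) → volume S ≤ count S * k
  volume≤ {k} S tf small = begin
    volume S ≡⟨ volume-degrees S ⟩
    sum (λ v → ⟦ S v ⟧ * degree S v) ≤⟨ sum-mono pointwise ⟩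
    sum (λ v → ⟦ S v ⟧ * k) ≡⟨ sym (*-distribʳ-sum k (λ v → ⟦ S v ⟧)) ⟩
    count S * k ∎
    where
    open ≤-Reasoning
    pointwise : ∀ v → ⟦ S v ⟧ * degree S v ≤ ⟦ S v ⟧ * k
    pointwise v with S v in v∈S
    ... | false = z≤n
    ... | true = *-monoʳ-≤ 1 (degree≤ tf v∈S small)

-- Computable lower bounds on the number of edges

maximum minimum : (ℕ → ℕ) → ℕ → ℕ
maximum f zero    = 0
maximum f (suc n) = f n ⊔′ maximum f n
minimum f zero    = f 0
minimum f (suc n) = f (suc n) ⊓′ minimum f n

maximum-lub : ∀ f {n b} → (∀ i → i < n → f i ≤ b) → maximum f n ≤ b
maximum-lub f {zero}      _   = z≤n
maximum-lub f {suc n} {b} f≤b = subst (_≤ b) (⊔≡⊔′ (f n) (maximum f n))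
  (⊔-lub (f≤b n ≤-refl) (maximum-lub f (λ i i<n → f≤b i (m≤n⇒m≤1+n i<n))))

minimum-≤ : ∀ f n {i} → i ≤ n → minimum f n ≤ f i
minimum-≤ f zero    z≤n = ≤-refl
minimum-≤ f (suc n) {i} i≤1+n = subst (_≤ f i) (⊓≡⊓′ (f (suc n)) (minimum f n)) (go (m≤n⇒m<n∨m≡n i≤1+n))
  where
  go : i < suc n ⊎ i ≡ suc n → f (suc n) ⊓ minimum f n ≤ f i
  go (inj₁ (s≤s i≤n)) = ≤-trans (m⊓n≤n (f (suc n)) (minimum f n)) (minimum-≤ f n i≤n)
  go (inj₂ refl)      = m⊓n≤m (f (suc n)) (minimum f n)

-- Stands for ∞: larger than n (k − 1) for all n ≤ 39 and k ≤ 9, hence than every possible volume.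
unbounded : ℕ
unbounded = 2000

intercept : ℕ → (ℕ → ℕ) → ℕ → ℕ → ℕ
intercept k E n a = minimum (λ d → (E (n ∸ suc d) + 2 * (d * d)) ∸ a * d) k

-- If a d + b ≤ E (n − 1 − d) + 2 d² for all d ≤ k then volume-certificate gives volume ≥ ⌈n b / (n − a)⌉; here
-- j + 1 = n − a.  Where the truncated subtraction in intercept bites, b = 0 and the bound is vacuous.
slopeBound : ℕ → (ℕ → ℕ) → ℕ → ℕ → ℕ
slopeBound k E n j = (n * intercept k E n (n ∸ suc j) + j) / suc j

-- All degrees are at most k, so a lower bound above n k shows that there is nothing to bound.
improve : ℕ → (ℕ → ℕ) → ℕ → ℕ
improve k E n = cap (maximum (slopeBound k E n) n)
  where
  cap : ℕ → ℕ
  cap e = if n * k <ᵇ e then unbounded else e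

at : List ℕ → ℕ → ℕ
at []       _       = 0
at (x ∷ _)  zero    = x
at (_ ∷ xs) (suc n) = at xs n

at-applyUpTo : ∀ f m n → at (applyUpTo f m) n ≡ f n ⊎ at (applyUpTo f m) n ≡ 0
at-applyUpTo f zero    n       = inj₂ refl
at-applyUpTo f (suc m) zero    = inj₁ refl
at-applyUpTo f (suc m) (suc n) = at-applyUpTo (f ∘ suc) m n

-- Tabulated so that each row is evaluated once; out of range the bound is 0.
volumeBound : ℕ → ℕ → ℕ
volumeBound zero    = λ _ → unbounded
volumeBound (suc k) = at (applyUpTo (improve k (volumeBound k)) 40)

module EdgeBounds {N : ℕ} (h : Fin N → Fin N → Bool)
  (h-sym : ∀ x y → h x y ≡ h y x) (h-irrefl : ∀ x → h x x ≡ false) where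

  open Edges h h-sym h-irrefl

  slopeBound-sound : ∀ k E S → VolumeBound k E → TriangleFree S → AllIndependent< S (suc k) →
    ∀ j → j < count S → slopeBound k E (count S) j ≤ volume S
  slopeBound-sound k E S bound tf small j j<n =
    -- Adding `j` before dividing by `suc j` rounds up, so it suffices that `s * b` is at most
    -- `volume S * suc j`.
    ≤-pred (m<n*o⇒m/o<n {n = suc (volume S)} (begin-strict
      s * b + j                    <⟨ +-monoʳ-< (s * b) (n<1+n j) ⟩
      s * b + suc j                ≤⟨ +-monoˡ-≤ (suc j) (scaled b refl) ⟩
      volume S * suc j + suc j     ≡⟨ +-comm (volume S * suc j) (suc j) ⟩
      suc (volume S) * suc j       ∎))
    where
    open ≤-Reasoning
    s = count S
    a = s ∸ suc j
    b = intercept k E s a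
    a+j+1≡s : a + suc j ≡ s
    a+j+1≡s = m∸n+n≡m j<n
    -- A positive minimum forces every difference under it to be positive, so no subtraction was
    -- truncated.
    positive-line : ∀ c → suc c ≡ b → ∀ d → d ≤ k → a * d + suc c ≤ E (s ∸ suc d) + 2 * (d * d)
    positive-line c eq d d≤k = begin
      a * d + suc c                            ≤⟨ +-monoʳ-≤ (a * d) b≤ ⟩
      a * d + (E′ ∸ a * d)                     ≡⟨ m+[n∸m]≡n (<⇒≤ below) ⟩
      E′                                       ∎
      where
      E′ = E (s ∸ suc d) + 2 * (d * d)
      b≤ : suc c ≤ E′ ∸ a * d
      b≤ = subst (_≤ E′ ∸ a * d) (sym eq) (minimum-≤ (λ d → (E (s ∸ suc d) + 2 * (d * d)) ∸ a * d) k d≤k)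
      below : a * d < E′
      below = m∸n≢0⇒n<m (λ z → contradiction (subst (suc c ≤_) z b≤) λ ())
    scaled : ∀ c → c ≡ b → s * c ≤ volume S * suc j
    scaled zero    _  = ≤-trans (≤-reflexive (*-zeroʳ s)) z≤n
    scaled (suc c) eq = +-cancelˡ-≤ (a * volume S) (s * suc c) (volume S * suc j) (begin
      a * volume S + s * suc c             ≤⟨ volume-certificate k E a (suc c) S bound tf small (positive-line c eq) ⟩
      s * volume S                         ≡⟨ cong (_* volume S) (sym a+j+1≡s) ⟩
      (a + suc j) * volume S               ≡⟨ *-distribʳ-+ (volume S) a (suc j) ⟩
      a * volume S + suc j * volume S      ≡⟨ cong (a * volume S +_) (*-comm (suc j) (volume S)) ⟩
      a * volume S + volume S * suc j      ∎)

  improve-sound : ∀ k E → VolumeBound k E → VolumeBound (suc k) (improve k E)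
  improve-sound k E bound S tf small with count S * k <ᵇ maximum (slopeBound k E (count S)) (count S) in eq
  ... | false = maximum-lub _ (slopeBound-sound k E S bound tf small)
  ... | true  = contradiction
    (≤-trans (<ᵇ⇒< _ _ (subst T (sym eq) tt)) (maximum-lub _ (slopeBound-sound k E S bound tf small)))
    (≤⇒≯ (volume≤ S tf small))

  volumeBound-sound : ∀ k → VolumeBound k (volumeBound k)
  volumeBound-sound zero    S tf small = contradiction (small [] ([] , [])) λ ()
  volumeBound-sound (suc k) S tf small =
    tabulated (at-applyUpTo (improve k (volumeBound k)) 40 (count S))
      (improve-sound k (volumeBound k) (volumeBound-sound k) S tf small)
    where
    tabulated : ∀ {a b c} → a ≡ b ⊎ a ≡ 0 → b ≤ c → a ≤ c
    tabulated (inj₁ refl) b≤c = b≤c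
    tabulated (inj₂ refl) _   = z≤n

  -- `volumeBound` bounds the volume from below, the maximal degree `k` bounds it from above. The
  -- two can clash only where `improve` has returned `unbounded`.
  ramsey : ∀ k S → count S * k < volumeBound (suc k) (count S) → TriangleFree S → ¬ AllIndependent< S (suc k)
  ramsey k S large tf small =
    <⇒≱ large (≤-trans (volumeBound-sound (suc k) S tf small) (volume≤ S tf small))

-- gap m bounds χ − ω for graphs with n − χ = m ≤ 20.  It majorises m + 1 − α, where α is the least independence
-- number of a triangle-free graph on 2m + 1 vertices (given R(10,3) ≤ 41 if m = 20), and is superadditive.
gap : ℕ → ℕ
gap = at (0 ∷ 0 ∷ 1 ∷ 1 ∷ 2 ∷ 2 ∷ 3 ∷ 3 ∷ 4 ∷ 4 ∷ 5 ∷ 6 ∷ 6 ∷ 7 ∷ 8 ∷ 8 ∷ 9 ∷ 10 ∷ 10 ∷ 11 ∷ 11 ∷ [])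

gap≤ : ∀ {m} → m < 21 → gap m ≤ m
gap≤ = from-yes (allUpTo? (λ m → gap m ≤? m) 21)

-- Pays for the deletion of an independent triple, which lowers `m` by two and the number of colours
-- by one.
gap-2+ : ∀ {m} → m < 19 → suc (gap m) ≤ gap (2 + m)
gap-2+ = from-yes (allUpTo? (λ m → suc (gap m) ≤? gap (2 + m)) 19)

-- For a complement that splits into two parts with no edge between them, where matching sizes and
-- independent sets add up.
gap-+ : ∀ {m} → m < 21 → ∀ {n} → n < 21 ∸ m → gap m + gap n ≤ gap (m + n)
gap-+ = from-yes (allUpTo? (λ m → allUpTo? (λ n → gap m + gap n ≤? gap (m + n)) (21 ∸ m)) 21)

-- Through `ramsey` this says R(k + 1, 3) ≤ 2m + 1 for k = m - gap m; it is decided by evaluating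
-- the tables of edge bounds.
gap-ramsey : ∀ {m} → m < 20 → suc (2 * m) * (m ∸ gap m) < volumeBound (suc (m ∸ gap m)) (suc (2 * m))
gap-ramsey = from-yes (allUpTo? (λ m → suc (2 * m) * (m ∸ gap m) <? volumeBound (suc (m ∸ gap m)) (suc (2 * m))) 20)

-- Matchings as involutions

infix 4 _≺_

_≺_ : Fin N → Fin N → Bool
x ≺ y = toℕ x <ᵇ toℕ y

<⇒≺ : ∀ {x y : Fin N} → toℕ x < toℕ y → (x ≺ y) ≡ true
<⇒≺ x<y = Equivalence.to T-≡ (<⇒<ᵇ x<y)

≺⇒< : ∀ {x y : Fin N} → (x ≺ y) ≡ true → toℕ x < toℕ y
≺⇒< {x = x} {y} e = <ᵇ⇒< (toℕ x) (toℕ y) (subst T (sym e) tt)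

≮⇒⊀ : ∀ {x y : Fin N} → ¬ toℕ x < toℕ y → (x ≺ y) ≡ false
≮⇒⊀ x≮y = ¬-not (x≮y ∘ ≺⇒<)

-- In an involution every exchanged pair has one ascent and one descent, so `ascents` is the number
-- of edges of a matching and `fixedPoints` the number of unmatched vertices.
ascents descents fixedPoints : (Fin N → Fin N) → ℕ
ascents     p = sum (λ x → ⟦ x ≺ p x ⟧)
descents    p = sum (λ x → ⟦ p x ≺ x ⟧)
fixedPoints p = sum (λ x → ⟦ p x == x ⟧)

module _ (p : Fin N → Fin N) (involutive : ∀ x → p (p x) ≡ x) where

  -- Reindexing the sum along `p` itself turns ascents into descents.
  descents≡ascents : descents p ≡ ascents p
  descents≡ascents = sym (trans (sum-permute (λ x → ⟦ x ≺ p x ⟧) (permutation p p involutive involutive))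
    (sum-cong-≗ (λ x → cong (λ y → ⟦ p x ≺ y ⟧) (involutive x))))

  fixedPoints+ascents : fixedPoints p + 2 * ascents p ≡ N
  fixedPoints+ascents = begin
    fixedPoints p + 2 * ascents p
      ≡⟨ cong (λ d → fixedPoints p + (ascents p + d)) (trans (+-identityʳ (ascents p)) (sym descents≡ascents)) ⟩
    fixedPoints p + (ascents p + descents p)
      ≡⟨ sym (+-assoc (fixedPoints p) (ascents p) (descents p)) ⟩
    fixedPoints p + ascents p + descents p
      ≡⟨ sym (sum-+₃ (λ x → ⟦ p x == x ⟧) (λ x → ⟦ x ≺ p x ⟧) (λ x → ⟦ p x ≺ x ⟧)) ⟩
    sum (λ x → ⟦ p x == x ⟧ + ⟦ x ≺ p x ⟧ + ⟦ p x ≺ x ⟧)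
      ≡⟨ sum-cong-≗ trichotomy ⟩
    sum {N} (λ _ → 1)
      ≡⟨ count-full N ⟩
    N ∎
    where
    open ≡-Reasoning
    trichotomy : ∀ x → ⟦ p x == x ⟧ + ⟦ x ≺ p x ⟧ + ⟦ p x ≺ x ⟧ ≡ 1
    trichotomy x with <ᶠ-cmp x (p x)
    ... | tri< l ≢ ≯ rewrite ≢⇒==-false (≢ ∘ sym) | <⇒≺ l | ≮⇒⊀ ≯ = refl
    ... | tri≈ ≮ ≡ ≯ rewrite ≡⇒== (sym ≡) | ≮⇒⊀ ≮ | ≮⇒⊀ ≯ = refl
    ... | tri> ≮ ≢ g rewrite ≢⇒==-false (≢ ∘ sym) | ≮⇒⊀ ≮ | <⇒≺ g = refl

fixedPoints-ascents : ∀ (p q : Fin N → Fin N) → (∀ x → p (p x) ≡ x) → (∀ x → q (q x) ≡ x) →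
  ascents p ≡ ascents q → fixedPoints p ≡ fixedPoints q
fixedPoints-ascents p q p-inv q-inv eq = +-cancelʳ-≡ (2 * ascents p) (fixedPoints p) (fixedPoints q)
  (trans (fixedPoints+ascents p p-inv) (trans (sym (fixedPoints+ascents q q-inv))
    (cong (λ a → fixedPoints q + 2 * a) (sym eq))))

module Matchings (h : Fin N → Fin N → Bool)
  (h-sym : ∀ x y → h x y ≡ h y x) (h-irrefl : ∀ x → h x x ≡ false) where

  open Edges h h-sym h-irrefl

  -- Vertices outside `S` are fixed points. With the involution defined on all of `Fin N`, a
  -- matching of a smaller set is one of a larger set with the same `mate`.
  record Matching (S : Sub N) : Set where
    field
      mate       : Fin N → Fin N
      involutive : ∀ x → mate (mate x) ≡ x
      edge       : ∀ x → mate x ≢ x → x ∈ S × h x (mate x) ≡ true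
    size : ℕ
    size = ascents mate

    mate-∈ : ∀ x → mate x ≢ x → mate x ∈ S
    mate-∈ x moved = proj₁ (edge (mate x) (λ e → moved (trans (sym e) (involutive x))))

  open Matching public

  h⇒≢ : ∀ {x y} → h x y ≡ true → x ≢ y
  h⇒≢ xy refl = true≢false xy (h-irrefl _)

  emptyMatching : ∀ S → Matching S
  emptyMatching S = record { mate = id ; involutive = λ _ → refl ; edge = λ x x≢x → contradiction refl x≢x }

  Matching-⊑ : ∀ {S T} → S ⊑ T → Matching S → Matching T
  Matching-⊑ S⊑T M = record
    { mate = mate M ; involutive = involutive M
    ; edge = λ x moved → S⊑T x (proj₁ (edge M x moved)) , proj₂ (edge M x moved) }

  -- Matches the free vertex x with y, releasing the former partner of y.
  module Rematch {S} (M : Matching S) {x y} (x∈S : x ∈ S) (y∈S : y ∈ S)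
    (xy : h x y ≡ true) (x-free : mate M x ≡ x) where

    private
      x≢y : x ≢ y
      x≢y = h⇒≢ xy

      choose : ∀ w → Dec (w ≡ x) → Dec (w ≡ y) → Dec (mate M w ≡ y) → Fin N
      choose w (yes _) _       _       = y
      choose w (no _)  (yes _) _       = x
      choose w (no _)  (no _)  (yes _) = w
      choose w (no _)  (no _)  (no _)  = mate M w

    mate′ : Fin N → Fin N
    mate′ w = choose w (w ≟ x) (w ≟ y) (mate M w ≟ y)

    at-x : mate′ x ≡ y
    at-x with x ≟ x
    ... | yes _  = refl
    ... | no x≢x = contradiction refl x≢x

    at-y : mate′ y ≡ x
    at-y with y ≟ x | y ≟ y
    ... | yes y≡x | _      = contradiction (sym y≡x) x≢y
    ... | no _    | yes _  = refl
    ... | no _    | no y≢y = contradiction refl y≢y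

    at-partner : ∀ {w} → w ≢ x → w ≢ y → mate M w ≡ y → mate′ w ≡ w
    at-partner {w} w≢x w≢y e with w ≟ x | w ≟ y | mate M w ≟ y
    ... | yes w≡x | _       | _      = contradiction w≡x w≢x
    ... | no _    | yes w≡y | _      = contradiction w≡y w≢y
    ... | no _    | no _    | yes _  = refl
    ... | no _    | no _    | no ≢y  = contradiction e ≢y

    at-other : ∀ {w} → w ≢ x → w ≢ y → mate M w ≢ y → mate′ w ≡ mate M w
    at-other {w} w≢x w≢y ≢y with w ≟ x | w ≟ y | mate M w ≟ y
    ... | yes w≡x | _       | _      = contradiction w≡x w≢x
    ... | no _    | yes w≡y | _      = contradiction w≡y w≢y
    ... | no _    | no _    | yes e  = contradiction e ≢y
    ... | no _    | no _    | no _   = refl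

    -- The four branches of `choose` with their side conditions, so that each proof about `mate′`
    -- needs a single case split.
    data Position (w : Fin N) : Set where
      is-x       : w ≡ x → Position w
      is-y       : w ≡ y → Position w
      is-partner : w ≢ x → w ≢ y → mate M w ≡ y → Position w
      is-other   : w ≢ x → w ≢ y → mate M w ≢ y → Position w

    position : ∀ w → Position w
    position w with w ≟ x | w ≟ y | mate M w ≟ y
    ... | yes e | _     | _     = is-x e
    ... | no _  | yes e | _     = is-y e
    ... | no a  | no b  | yes c = is-partner a b c
    ... | no a  | no b  | no c  = is-other a b c

    rematch : Matching S
    rematch = record { mate = mate′ ; involutive = inv ; edge = edg }
      where
      inv : ∀ w → mate′ (mate′ w) ≡ w
      inv w with position w
      ... | is-x refl          = trans (cong mate′ at-x) at-y
      ... | is-y refl          = trans (cong mate′ at-y) at-x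
      ... | is-partner a b c   = trans (cong mate′ (at-partner a b c)) (at-partner a b c)
      ... | is-other a b c     = trans (cong mate′ (at-other a b c))
        (trans (at-other (λ e → a (trans (sym (involutive M w)) (trans (cong (mate M) e) x-free))) c
                         (λ e → b (trans (sym (involutive M w)) e)))
               (involutive M w))
      edg : ∀ w → mate′ w ≢ w → w ∈ S × h w (mate′ w) ≡ true
      edg w moved with position w
      ... | is-x refl rewrite at-x = x∈S , xy
      ... | is-y refl rewrite at-y = y∈S , trans (h-sym y x) xy
      ... | is-partner a b c = contradiction (at-partner a b c) moved
      ... | is-other a b c rewrite at-other a b c = edge M w moved

    -- The size follows from the fixed points by `fixedPoints+ascents`. Here `x` and `y` stop being
    -- fixed, and no partner is released.
    size-augment : mate M y ≡ y → size rematch ≡ suc (size M)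
    size-augment y-free = *-cancelˡ-≡ (size rematch) (suc (size M)) 2 (+-cancelˡ-≡ (fixedPoints mate′) _ _ (begin
      fixedPoints mate′ + 2 * size rematch     ≡⟨ fixedPoints+ascents mate′ (involutive rematch) ⟩
      N                                        ≡⟨ sym (fixedPoints+ascents (mate M) (involutive M)) ⟩
      fixedPoints (mate M) + 2 * size M        ≡⟨ cong (_+ 2 * size M) (sym fewer) ⟩
      fixedPoints mate′ + 1 + 1 + 2 * size M   ≡⟨ regroup (fixedPoints mate′) (size M) ⟩
      fixedPoints mate′ + 2 * suc (size M)     ∎))
      where
      open ≡-Reasoning
      regroup : ∀ f s → f + 1 + 1 + 2 * s ≡ f + 2 * suc s
      regroup = solve-∀
      pointwise : ∀ w → ⟦ mate′ w == w ⟧ + ⟦ w == x ⟧ + ⟦ w == y ⟧ ≡ ⟦ mate M w == w ⟧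
      pointwise w with position w
      ... | is-x refl rewrite at-x | x-free | ==-refl x | ≢⇒==-false x≢y | ≢⇒==-false (x≢y ∘ sym) = refl
      ... | is-y refl rewrite at-y | y-free | ==-refl y | ≢⇒==-false x≢y | ≢⇒==-false (x≢y ∘ sym) = refl
      ... | is-partner a b c = contradiction (trans (sym (involutive M w)) (trans (cong (mate M) c) y-free)) b
      ... | is-other a b c rewrite at-other a b c | ≢⇒==-false a | ≢⇒==-false b =
        trans (+-identityʳ _) (+-identityʳ _)
      fewer : fixedPoints mate′ + 1 + 1 ≡ fixedPoints (mate M)
      fewer = begin
        fixedPoints mate′ + 1 + 1
          ≡⟨ cong₂ (λ a b → fixedPoints mate′ + a + b) (sym (count-singleton x)) (sym (count-singleton y)) ⟩
        fixedPoints mate′ + sum (λ w → ⟦ w == x ⟧) + sum (λ w → ⟦ w == y ⟧)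
          ≡⟨ sym (sum-+₃ (λ w → ⟦ mate′ w == w ⟧) (λ w → ⟦ w == x ⟧) (λ w → ⟦ w == y ⟧)) ⟩
        sum (λ w → ⟦ mate′ w == w ⟧ + ⟦ w == x ⟧ + ⟦ w == y ⟧)
          ≡⟨ sum-cong-≗ pointwise ⟩
        fixedPoints (mate M) ∎

    -- `x` stops being fixed and the former partner `z` of `y` becomes fixed.
    size-switch : mate M y ≢ y → size rematch ≡ size M
    size-switch y-used = *-cancelˡ-≡ (size rematch) (size M) 2 (+-cancelˡ-≡ (fixedPoints mate′) _ _ (begin
      fixedPoints mate′ + 2 * size rematch     ≡⟨ fixedPoints+ascents mate′ (involutive rematch) ⟩
      N                                        ≡⟨ sym (fixedPoints+ascents (mate M) (involutive M)) ⟩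
      fixedPoints (mate M) + 2 * size M        ≡⟨ cong (_+ 2 * size M) (sym same) ⟩
      fixedPoints mate′ + 2 * size M           ∎))
      where
      open ≡-Reasoning
      z = mate M y
      mate-z : mate M z ≡ y
      mate-z = involutive M y
      x≢z : x ≢ z
      x≢z e = x≢y (trans (sym x-free) (trans (cong (mate M) e) mate-z))
      pointwise : ∀ w → ⟦ mate′ w == w ⟧ + ⟦ w == x ⟧ ≡ ⟦ mate M w == w ⟧ + ⟦ w == z ⟧
      pointwise w with position w
      ... | is-x refl rewrite at-x | x-free | ==-refl x | ≢⇒==-false (x≢y ∘ sym) | ≢⇒==-false x≢z = refl
      ... | is-y refl rewrite at-y | ≢⇒==-false x≢y | ≢⇒==-false (x≢y ∘ sym) | ≢⇒==-false y-used
                            | ≢⇒==-false (y-used ∘ sym) = refl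
      ... | is-partner a b c with trans (sym (involutive M w)) (cong (mate M) c)
      ...   | refl rewrite at-partner a b c | ==-refl z | ≢⇒==-false a | c | ≢⇒==-false (y-used ∘ sym) = refl
      pointwise w | is-other a b c rewrite at-other a b c | ≢⇒==-false a
        | ≢⇒==-false (λ w≡z → c (trans (cong (mate M) w≡z) mate-z)) = refl
      same : fixedPoints mate′ ≡ fixedPoints (mate M)
      same = +-cancelʳ-≡ 1 _ _ (begin
        fixedPoints mate′ + 1
          ≡⟨ cong (fixedPoints mate′ +_) (sym (count-singleton x)) ⟩
        fixedPoints mate′ + sum (λ w → ⟦ w == x ⟧)
          ≡⟨ sym (∑-distrib-+ (λ w → ⟦ mate′ w == w ⟧) (λ w → ⟦ w == x ⟧)) ⟩
        sum (λ w → ⟦ mate′ w == w ⟧ + ⟦ w == x ⟧)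
          ≡⟨ sum-cong-≗ pointwise ⟩
        sum (λ w → ⟦ mate M w == w ⟧ + ⟦ w == z ⟧)
          ≡⟨ ∑-distrib-+ (λ w → ⟦ mate M w == w ⟧) (λ w → ⟦ w == z ⟧) ⟩
        fixedPoints (mate M) + sum (λ w → ⟦ w == z ⟧)
          ≡⟨ cong (fixedPoints (mate M) +_) (count-singleton z) ⟩
        fixedPoints (mate M) + 1 ∎)

-- The Gallai–Lovász decomposition

-- The inequality finally sought is decidable, so the argument may run under a double negation.
-- There excluded middle is available, and by this lemma for finitely many propositions at once.
¬¬-decideAll : ∀ {n} (P : Fin n → Set) → ¬ ¬ (∀ i → Dec (P i))
¬¬-decideAll {zero}  P k = k (λ ())
¬¬-decideAll {suc n} P k = ¬¬-excluded-middle (λ p → ¬¬-decideAll (P ∘ suc) (λ ps →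
  k (λ { zero → p ; (suc i) → ps i })))

gap-mono : ∀ {m n} → m ≤ n → n < 21 → gap m ≤ gap n
gap-mono {m} {n} m≤n n<21 = begin
  gap m                    ≤⟨ m≤m+n (gap m) (gap (n ∸ m)) ⟩
  gap m + gap (n ∸ m)      ≤⟨ gap-+ (≤-<-trans m≤n n<21) (∸-monoˡ-< n<21 m≤n) ⟩
  gap (m + (n ∸ m))        ≡⟨ cong gap (m+[n∸m]≡n m≤n) ⟩
  gap n                    ∎
  where open ≤-Reasoning

module Extremal (h : Fin N → Fin N → Bool)
  (h-sym : ∀ x y → h x y ≡ h y x) (h-irrefl : ∀ x → h x x ≡ false) where

  open Edges h h-sym h-irrefl
  open Matchings h h-sym h-irrefl

  module CommonlyMissed (S : Sub N) (m : ℕ) (bounded : ∀ (M : Matching S) → size M ≤ m)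
    (missed : ∀ v → v ∈ S → ¬ ¬ (Σ (Matching S) λ M → m ≤ size M × mate M v ≡ v)) where

    -- By `bounded`, a matching of size at least `m` is maximum. The negation of `Joint` is the
    -- equivalence relation of Gallai and Lovász; the component `u ≢ v` makes that negation
    -- reflexive.
    Joint : Fin N → Fin N → Set
    Joint u v = u ≢ v × Σ (Matching S) λ M → m ≤ size M × mate M u ≡ u × mate M v ≡ v

    not-augmentable : ∀ (M : Matching S) {x y} → m ≤ size M → x ∈ S → y ∈ S → mate M x ≡ x → mate M y ≡ y →
      h x y ≡ true → ⊥
    not-augmentable M m≤ x∈S y∈S x-free y-free xy =
      <⇒≱ (s≤s m≤) (subst (_≤ m) (size-augment y-free) (bounded rematch))
      where open Rematch M x∈S y∈S xy x-free

    -- The edge would augment a matching that misses both ends. Hence every edge lies inside one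
    -- class.
    adjacent⇒¬Joint : ∀ {x y} → x ∈ S → y ∈ S → h x y ≡ true → ¬ Joint x y
    adjacent⇒¬Joint x∈S y∈S xy (_ , M , m≤ , x-free , y-free) = not-augmentable M m≤ x∈S y∈S x-free y-free xy

    private
      disagreement : Matching S → Matching S → ℕ
      disagreement M K = sum (λ w → ⟦ not (mate K w == mate M w) ⟧)

    -- Let K miss t.  Rematching K along edges of M keeps it maximum and missing t and brings it closer to M; once
    -- this is impossible, every vertex other than t missed by K is missed by M.  As u and v are missed by M but not
    -- by K, this contradicts |K| = |M|.
    module _ (M : Matching S) (m≤M : m ≤ size M) {u v t : Fin N} (u≢v : u ≢ v)
      (u-free : mate M u ≡ u) (v-free : mate M v ≡ v) (u≢t : u ≢ t) (t≢v : t ≢ v)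
      (¬ut : ¬ Joint u t) (¬tv : ¬ Joint t v) where

      private
        -- `f` bounds the disagreement with `M`, which falls at each rematching, and makes the
        -- recursion structural.
        no-common : ∀ f (K : Matching S) → m ≤ size K → mate K t ≡ t → disagreement M K ≤ f → ⊥
        no-common f K m≤K t-free dis
          with any? (λ x → ¬? (x ≟ t) ×-dec (mate K x ≟ x) ×-dec ¬? (mate M x ≟ x))
        ... | no none = <⇒≱ (n<1+n (suc (fixedPoints (mate M)))) (begin
            suc (suc (fixedPoints (mate M)))
              ≡⟨ cong (λ f → suc (suc f)) (fixedPoints-ascents (mate M) (mate K) (involutive M) (involutive K)
                   (≤-antisym (≤-trans (bounded M) m≤K) (≤-trans (bounded K) m≤M))) ⟩
            suc (suc (fixedPoints (mate K)))
              ≡⟨ shift (fixedPoints (mate K)) ⟩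
            fixedPoints (mate K) + 1 + 1
              ≡⟨ cong₂ (λ a b → fixedPoints (mate K) + a + b) (sym (count-singleton u)) (sym (count-singleton v)) ⟩
            fixedPoints (mate K) + sum (λ w → ⟦ w == u ⟧) + sum (λ w → ⟦ w == v ⟧)
              ≡⟨ sym (sum-+₃ (λ w → ⟦ mate K w == w ⟧) (λ w → ⟦ w == u ⟧) (λ w → ⟦ w == v ⟧)) ⟩
            sum (λ w → ⟦ mate K w == w ⟧ + ⟦ w == u ⟧ + ⟦ w == v ⟧)
              ≤⟨ sum-mono pointwise ⟩
            sum (λ w → ⟦ w == t ⟧ + ⟦ mate M w == w ⟧)
              ≡⟨ ∑-distrib-+ (λ w → ⟦ w == t ⟧) (λ w → ⟦ mate M w == w ⟧) ⟩
            sum (λ w → ⟦ w == t ⟧) + fixedPoints (mate M)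
              ≡⟨ cong (_+ fixedPoints (mate M)) (count-singleton t) ⟩
            suc (fixedPoints (mate M)) ∎)
          where
          open ≤-Reasoning
          shift : ∀ f → suc (suc f) ≡ f + 1 + 1
          shift = solve-∀
          u-used : mate K u ≢ u
          u-used e = ¬ut (u≢t , K , m≤K , e , t-free)
          v-used : mate K v ≢ v
          v-used e = ¬tv (t≢v , K , m≤K , t-free , e)
          pointwise : ∀ w → ⟦ mate K w == w ⟧ + ⟦ w == u ⟧ + ⟦ w == v ⟧ ≤ ⟦ w == t ⟧ + ⟦ mate M w == w ⟧
          pointwise w with w ≟ u
          ... | yes refl rewrite ≢⇒==-false u-used | ≢⇒==-false u≢v | u-free | ==-refl w = m≤n+m 1 ⟦ w == t ⟧
          ... | no _ with w ≟ v
          ...   | yes refl rewrite ≢⇒==-false v-used | v-free | ==-refl w = m≤n+m 1 ⟦ w == t ⟧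
          ...   | no _ with w ≟ t | mate K w ≟ w
          ...     | _       | no _  = z≤n
          ...     | yes _   | yes _ = s≤s z≤n
          ...     | no w≢t  | yes e with mate M w ≟ w
          ...       | yes _ = ≤-refl
          ...       | no ≢w = contradiction (w , w≢t , e , ≢w) none
        -- `x` is missed by `K`, and `M` joins it to some `y`. If `K` missed `y` as well, the edge
        -- would augment `K`; otherwise `x` takes `y` away from its partner in `K`.
        no-common f K m≤K t-free dis | yes (x , x≢t , x-free , x-used)
          with edge M x x-used | mate K (mate M x) ≟ mate M x
        ... | x∈S , xy | yes y-free = not-augmentable K m≤K x∈S (mate-∈ M x x-used) x-free y-free xy
        ... | x∈S , xy | no y-used = continue f dis
          where
          y = mate M x
          open Rematch K x∈S (mate-∈ M x x-used) xy x-free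
          t-free′ : mate′ t ≡ t
          t-free′ with position t
          ... | is-x e           = contradiction (sym e) x≢t
          ... | is-y refl        = contradiction t-free y-used
          ... | is-partner a b c = at-partner a b c
          ... | is-other a b c   = trans (at-other a b c) t-free
          -- After the switch the new matching agrees with `M` at `x` and `y`. The only other vertex
          -- whose mate changes is the former partner of `y`, where `K` and `M` differed already
          -- because `M` joins `y` to `x`.
          pointwise : ∀ w → ⟦ w == x ⟧ + ⟦ not (mate′ w == mate M w) ⟧ ≤ ⟦ not (mate K w == mate M w) ⟧
          pointwise w with position w
          ... | is-x refl rewrite at-x | ==-refl x | ==-refl y | x-free | ≢⇒==-false (x-used ∘ sym) = ≤-refl
          ... | is-y refl rewrite at-y | ≢⇒==-false x-used | involutive M x | ==-refl x = z≤n
          ... | is-partner a b c rewrite at-partner a b c | ≢⇒==-false a | c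
                | ≢⇒==-false (λ e → a (trans (sym (involutive M w))
                    (trans (cong (mate M) (sym e)) (involutive M x)))) =
                at-most-one (not (w == mate M w))
            where
            at-most-one : ∀ b → ⟦ b ⟧ ≤ 1
            at-most-one true  = ≤-refl
            at-most-one false = z≤n
          ... | is-other a b c rewrite at-other a b c | ≢⇒==-false a = ≤-refl
          closer : suc (disagreement M rematch) ≤ disagreement M K
          closer = begin
            suc (disagreement M rematch)
              ≡⟨ cong (_+ disagreement M rematch) (sym (count-singleton x)) ⟩
            sum (λ w → ⟦ w == x ⟧) + disagreement M rematch
              ≡⟨ sym (∑-distrib-+ (λ w → ⟦ w == x ⟧) (λ w → ⟦ not (mate′ w == mate M w) ⟧)) ⟩
            sum (λ w → ⟦ w == x ⟧ + ⟦ not (mate′ w == mate M w) ⟧)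
              ≤⟨ sum-mono pointwise ⟩
            disagreement M K ∎
            where open ≤-Reasoning
          continue : ∀ f → disagreement M K ≤ f → ⊥
          continue zero    dis = contradiction (≤-trans closer dis) λ ()
          continue (suc f) dis = no-common f rematch (subst (m ≤_) (sym (size-switch y-used)) m≤K) t-free′
            (≤-pred (≤-trans closer dis))

      ¬Joint-step : t ∈ S → ⊥
      ¬Joint-step t∈S = missed t t∈S (λ (K , m≤K , t-free) → no-common _ K m≤K t-free ≤-refl)

    ¬Joint-trans : ∀ {u t v} → t ∈ S → ¬ Joint u t → ¬ Joint t v → ¬ Joint u v
    ¬Joint-trans {u} {t} {v} t∈S ¬ut ¬tv uv@(u≢v , M , m≤M , u-free , v-free) with u ≟ t | t ≟ v
    ... | yes refl | _        = ¬tv uv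
    ... | no _     | yes refl = ¬ut uv
    ... | no u≢t   | no t≢v   = ¬Joint-step M m≤M u≢v u-free v-free u≢t t≢v ¬ut ¬tv t∈S

    -- A maximum matching that misses `v` misses no other vertex of `S`, so `S` consists of `v` and
    -- `m` matched pairs.
    one-class : (∀ u v → u ∈ S → v ∈ S → ¬ Joint u v) → ∀ v → v ∈ S → ¬ ¬ (count S ≡ suc (2 * m))
    one-class joint-free v v∈S k = missed v v∈S (λ (M , m≤M , v-free) → k (size-determined M m≤M v-free))
      where
      size-determined : ∀ (M : Matching S) → m ≤ size M → mate M v ≡ v → count S ≡ suc (2 * m)
      size-determined M m≤M v-free = +-cancelʳ-≡ (fixedPoints (mate M)) _ _ (begin
        count S + fixedPoints (mate M)
          ≡⟨ sym (∑-distrib-+ (λ x → ⟦ S x ⟧) (λ x → ⟦ mate M x == x ⟧)) ⟩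
        sum (λ x → ⟦ S x ⟧ + ⟦ mate M x == x ⟧)
          ≡⟨ sum-cong-≗ pointwise ⟩
        sum (λ x → ⟦ x == v ⟧ + 1)
          ≡⟨ ∑-distrib-+ (λ x → ⟦ x == v ⟧) (λ _ → 1) ⟩
        sum (λ x → ⟦ x == v ⟧) + sum {N} (λ _ → 1)
          ≡⟨ cong₂ _+_ (count-singleton v) (count-full N) ⟩
        suc N
          ≡⟨ cong suc (sym (fixedPoints+ascents (mate M) (involutive M))) ⟩
        suc (fixedPoints (mate M) + 2 * size M)
          ≡⟨ cong suc (+-comm (fixedPoints (mate M)) (2 * size M)) ⟩
        suc (2 * size M) + fixedPoints (mate M)
          ≡⟨ cong (λ s → suc (2 * s) + fixedPoints (mate M)) (≤-antisym (bounded M) m≤M) ⟩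
        suc (2 * m) + fixedPoints (mate M) ∎)
        where
        open ≡-Reasoning
        pointwise : ∀ x → ⟦ S x ⟧ + ⟦ mate M x == x ⟧ ≡ ⟦ x == v ⟧ + 1
        pointwise x with x ≟ v
        ... | yes refl rewrite v-free | ==-refl x | v∈S = refl
        ... | no x≢v with mate M x ≟ x | S x in eq
        ...   | yes x-free | true  = ⊥-elim (joint-free x v eq v∈S (x≢v , M , m≤M , x-free , v-free))
        ...   | yes _      | false = refl
        ...   | no _       | true  = refl
        ...   | no moved   | false = ⊥-elim (true≢false (proj₁ (edge M x moved)) eq)

  combine : ∀ {S S₁ S₂} → S₁ ⊑ S → S₂ ⊑ S → (∀ x → x ∈ S₁ → x ∈ S₂ → ⊥) →
    (M₁ : Matching S₁) (M₂ : Matching S₂) → Σ (Matching S) λ M → size M ≡ size M₁ + size M₂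
  combine {S} {S₁} {S₂} S₁⊑S S₂⊑S disjoint M₁ M₂ = record { mate = p ; involutive = inv ; edge = edg } ,
    trans (sum-cong-≗ split) (∑-distrib-+ (λ x → ⟦ x ≺ mate M₁ x ⟧) (λ x → ⟦ x ≺ mate M₂ x ⟧))
    where
    choose : Fin N → Bool → Fin N
    choose x true  = mate M₁ x
    choose x false = mate M₂ x
    p : Fin N → Fin N
    p x = choose x (S₁ x)
    free₁ : ∀ {x} → S₁ x ≡ false → mate M₁ x ≡ x
    free₁ {x} x∉ = decidable-stable (mate M₁ x ≟ x) (λ moved → true≢false (proj₁ (edge M₁ x moved)) x∉)
    free₂ : ∀ {x} → x ∈ S₁ → mate M₂ x ≡ x
    free₂ {x} x∈ = decidable-stable (mate M₂ x ≟ x) (λ moved → disjoint x x∈ (proj₁ (edge M₂ x moved)))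
    stays₁ : ∀ {x} → x ∈ S₁ → mate M₁ x ∈ S₁
    stays₁ {x} x∈ with mate M₁ x ≟ x
    ... | yes e = subst (_∈ S₁) (sym e) x∈
    ... | no moved = mate-∈ M₁ x moved
    stays₂ : ∀ {x} → S₁ x ≡ false → S₁ (mate M₂ x) ≡ false
    stays₂ {x} x∉ with mate M₂ x ≟ x
    ... | yes e = subst (λ y → S₁ y ≡ false) (sym e) x∉
    ... | no moved = ¬-not (λ y∈ → disjoint (mate M₂ x) y∈ (mate-∈ M₂ x moved))
    inv : ∀ x → p (p x) ≡ x
    inv x with S₁ x in eq
    ... | true  rewrite stays₁ eq = involutive M₁ x
    ... | false rewrite stays₂ eq = involutive M₂ x
    edg : ∀ x → p x ≢ x → x ∈ S × h x (p x) ≡ true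
    edg x moved with S₁ x in eq
    ... | true  = S₁⊑S x eq , proj₂ (edge M₁ x moved)
    ... | false = S₂⊑S x (proj₁ (edge M₂ x moved)) , proj₂ (edge M₂ x moved)
    split : ∀ x → ⟦ x ≺ p x ⟧ ≡ ⟦ x ≺ mate M₁ x ⟧ + ⟦ x ≺ mate M₂ x ⟧
    split x with S₁ x in eq
    ... | true  rewrite free₂ eq | ≮⇒⊀ {x = x} {x} (<-irrefl refl) = sym (+-identityʳ _)
    ... | false rewrite free₁ eq | ≮⇒⊀ {x = x} {x} (<-irrefl refl) = refl

  -- Descends from `b` until some size is attained; the empty matching attains 0.
  maximumMatching : ∀ {S} b → (∀ (M : Matching S) → size M ≤ b) →
    ¬ ¬ (Σ ℕ λ m → Σ (Matching S) (λ M → size M ≡ m) × (∀ (M : Matching S) → size M ≤ m))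
  maximumMatching {S} zero    bounded k = k (0 , (emptyMatching S , n≤0⇒n≡0 (bounded (emptyMatching S))) , bounded)
  maximumMatching {S} (suc b) bounded k = ¬¬-excluded-middle λ
    { (yes attained) → k (suc b , attained , bounded)
    ; (no missed)    → maximumMatching b (λ M → ≤-pred (≤∧≢⇒< (bounded M) (λ e → missed (M , e)))) k }

  -- The inequality n - m - α ≤ gap m, written without subtraction.
  IndependentOfSize : Sub N → ℕ → Set
  IndependentOfSize S m = ∃[ l ] Independent S l × count S ≤ length l + m + gap m

  -- `small` expresses R(m - gap m + 1, 3) ≤ 2m + 1 for all `m ≤ K`. It will be supplied for K = 19,
  -- and under R(10,3) ≤ 41 for K = 20.
  module _ {K : ℕ} (K<21 : K < 21) (small : ∀ m → m ≤ K → ∀ S → TriangleFree S → count S ≡ suc (2 * m) →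
      ¬ AllIndependent< S (suc (m ∸ gap m))) where

    -- Induction on a bound `n` for the order. Deleting an `Essential` vertex allows `m` to drop by
    -- one; if no matching attains `m`, every vertex is essential. Without essential vertices each
    -- vertex is missed by a maximum matching, and `S` is either one class, to which `small`
    -- applies, or it splits.
    independent-of-matching : ∀ n m → m ≤ K → ∀ S → count S ≤ n → TriangleFree S →
      (∀ (M : Matching S) → size M ≤ m) → ¬ ¬ IndependentOfSize S m
    independent-of-matching zero    m m≤K S c≤n tf bounded k = k ([] , ([] , []) , ≤-trans c≤n z≤n)
    independent-of-matching (suc n) m m≤K S c≤n tf bounded k with 0 <? count S
    ... | no  empty    = k ([] , ([] , []) , ≤-trans (≮⇒≥ empty) z≤n)
    ... | yes nonempty = ¬¬-excluded-middle {A = Essential} λ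
      { (yes (v , v∈S , essential)) → delete m m≤K v∈S essential k
      ; (no ¬essential) → every-vertex-missed (missed ¬essential) }
      where
      Essential : Set
      Essential = ∃[ v ] v ∈ S × (∀ (M : Matching (S ∖ v)) → suc (size M) ≤ m)
      <21 : ∀ {a} → a ≤ K → a < 21
      <21 a≤K = ≤-<-trans a≤K K<21
      delete : ∀ m → m ≤ K → ∀ {v} → v ∈ S → (∀ (M : Matching (S ∖ v)) → suc (size M) ≤ m) → ¬ ¬ IndependentOfSize S m
      delete zero    _   {v} _   essential _ = contradiction (essential (emptyMatching (S ∖ v))) λ ()
      delete (suc m) m<K {v} v∈S essential k =
        independent-of-matching n m (<⇒≤ m<K) (S ∖ v)
          (≤-pred (subst (_≤ suc n) (count-∖ S v∈S) c≤n))
          (TriangleFree-⊑ (∖-⊑ S v) tf) (≤-pred ∘ essential)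
          λ (l , ind , c≤) → k (l , Independent-⊑ (∖-⊑ S v) ind , (begin
            count S                              ≡⟨ count-∖ S v∈S ⟩
            suc (count (S ∖ v))                  ≤⟨ s≤s c≤ ⟩
            suc (length l + m + gap m)           ≤⟨ s≤s (+-monoʳ-≤ (length l + m) (gap-mono (n≤1+n m) (<21 m<K))) ⟩
            suc (length l + m + gap (suc m))     ≡⟨ cong (_+ gap (suc m)) (sym (+-suc (length l) m)) ⟩
            length l + suc m + gap (suc m)       ∎))
        where open ≤-Reasoning
      missed : ¬ Essential →
        ∀ v → v ∈ S → ¬ ¬ (Σ (Matching S) λ M → m ≤ size M × mate M v ≡ v)
      missed ¬essential v v∈S none = ¬essential (v , v∈S , λ M → decidable-stable (size M <? m) (λ ≮m →
        none (Matching-⊑ (∖-⊑ S v) M , ≮⇒≥ ≮m ,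
          decidable-stable (mate M v ≟ v) (λ moved → ∖-∉ S v (proj₁ (edge M v moved))))))
      every-vertex-missed : (∀ v → v ∈ S → ¬ ¬ (Σ (Matching S) λ M → m ≤ size M × mate M v ≡ v)) → ⊥
      every-vertex-missed miss = ¬¬-excluded-middle {A = ∃[ u ] ∃[ v ] u ∈ S × v ∈ S × Joint u v} λ
        { (yes (u , v , u∈S , v∈S , uv)) → ¬¬-decideAll (Joint u) (λ dec → disconnected u∈S v∈S uv dec)
        ; (no ¬joint) → connected (λ u v u∈S v∈S uv → ¬joint (u , v , u∈S , v∈S , uv)) }
        where
        open CommonlyMissed S m bounded miss
        connected : (∀ u v → u ∈ S → v ∈ S → ¬ Joint u v) → ⊥
        connected ¬joint with count-positive S nonempty
        ... | v , v∈S = one-class ¬joint v v∈S λ odd → small m m≤K S tf odd λ l ind →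
          decidable-stable (length l <? suc (m ∸ gap m)) λ ≮ → k (l , ind , (begin
            count S                              ≡⟨ odd ⟩
            suc (m + (m + 0))                    ≡⟨ cong (λ a → suc (a + (m + 0))) (sym (m∸n+n≡m (gap≤ (<21 m≤K)))) ⟩
            suc (m ∸ gap m + gap m + (m + 0))    ≡⟨ regroup (m ∸ gap m) (gap m) m ⟩
            suc (m ∸ gap m) + m + gap m          ≤⟨ +-monoˡ-≤ (gap m) (+-monoˡ-≤ m (≮⇒≥ ≮)) ⟩
            length l + m + gap m                 ∎))
          where
          open ≤-Reasoning
          regroup : ∀ a g m → suc (a + g + (m + 0)) ≡ suc a + m + g
          regroup = solve-∀
        disconnected : ∀ {u v} → u ∈ S → v ∈ S → Joint u v → (∀ x → Dec (Joint u x)) → ⊥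
        disconnected {u} {v} u∈S v∈S uv dec =
          maximumMatching m (bounded ∘ Matching-⊑ S₁⊑S) λ (m₁ , (M₁ , size₁) , max₁) →
          maximumMatching m (bounded ∘ Matching-⊑ S₂⊑S) λ (m₂ , (M₂ , size₂) , max₂) →
          let M , size-M = combine S₁⊑S S₂⊑S disjoint M₁ M₂
              m₁+m₂≤m : m₁ + m₂ ≤ m
              m₁+m₂≤m = subst (_≤ m) (trans size-M (cong₂ _+_ size₁ size₂)) (bounded M)
          in
          independent-of-matching n m₁ (≤-trans (m+n≤o⇒m≤o m₁ m₁+m₂≤m) m≤K) S₁ c₁≤n (TriangleFree-⊑ S₁⊑S tf) max₁
            λ (l₁ , ind₁ , c₁≤) →
          independent-of-matching n m₂ (≤-trans (m+n≤o⇒n≤o m₁ m₁+m₂≤m) m≤K) S₂ c₂≤n (TriangleFree-⊑ S₂⊑S tf) max₂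
            λ (l₂ , ind₂ , c₂≤) →
          k (l₁ ++ l₂ , union ind₁ ind₂ , total m₁ m₂ l₁ l₂ m₁+m₂≤m c₁≤ c₂≤)
          where
          -- `S₁` is the class of `u`, and `S₂`, which contains `v`, is the union of the other
          -- classes. Both are nonempty, hence smaller than `S`.
          S₁ S₂ : Sub N
          S₁ x = S x ∧ not (does (dec x))
          S₂ x = S x ∧ does (dec x)
          S₁⊑S : S₁ ⊑ S
          S₁⊑S x = proj₁ ∘ ∧-true
          S₂⊑S : S₂ ⊑ S
          S₂⊑S x = proj₁ ∘ ∧-true
          ∈S₁ : ∀ {x} → x ∈ S₁ → ¬ Joint u x
          ∈S₁ {x} p with S x | dec x
          ... | true | no ¬ux = ¬ux
          ∈S₂ : ∀ {x} → x ∈ S₂ → Joint u x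
          ∈S₂ {x} p with S x | dec x
          ... | true | yes ux = ux
          disjoint : ∀ x → x ∈ S₁ → x ∈ S₂ → ⊥
          disjoint x p q = ∈S₁ p (∈S₂ q)
          count-sum : count S ≡ count S₁ + count S₂
          count-sum = trans (sum-cong-≗ pointwise) (∑-distrib-+ (λ x → ⟦ S₁ x ⟧) (λ x → ⟦ S₂ x ⟧))
            where
            pointwise : ∀ x → ⟦ S x ⟧ ≡ ⟦ S₁ x ⟧ + ⟦ S₂ x ⟧
            pointwise x with S x | dec x
            ... | true  | yes _ = refl
            ... | true  | no _  = refl
            ... | false | _     = refl
          nonempty₁ : 0 < count S₁
          nonempty₁ = subst (0 <_) (sym (count-∖ S₁ {u} u∈S₁)) z<s
            where
            u∈S₁ : u ∈ S₁
            u∈S₁ rewrite u∈S with dec u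
            ... | yes (u≢u , _) = contradiction refl u≢u
            ... | no _ = refl
          nonempty₂ : 0 < count S₂
          nonempty₂ = subst (0 <_) (sym (count-∖ S₂ {v} v∈S₂)) z<s
            where
            v∈S₂ : v ∈ S₂
            v∈S₂ rewrite v∈S with dec v
            ... | yes _  = refl
            ... | no ¬uv = contradiction uv ¬uv
          c₁≤n : count S₁ ≤ n
          c₁≤n = ≤-pred (≤-trans (m<m+n (count S₁) nonempty₂) (subst (_≤ suc n) count-sum c≤n))
          c₂≤n : count S₂ ≤ n
          c₂≤n = ≤-pred (≤-trans (m<n+m (count S₂) nonempty₁) (subst (_≤ suc n) count-sum c≤n))
          apart : ∀ {x y} → x ∈ S₁ → y ∈ S₂ → x ≢ y × h x y ≡ false
          -- An edge would put `x` and `y` into one class, and by transitivity `y` into the class of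
          -- `u`.
          apart {x} {y} x∈ y∈ = (λ { refl → disjoint x x∈ y∈ }) , ¬-not (λ xy →
            ¬Joint-trans (S₁⊑S x x∈) (∈S₁ x∈) (adjacent⇒¬Joint (S₁⊑S x x∈) (S₂⊑S y y∈) xy) (∈S₂ y∈))
          union : ∀ {l₁ l₂} → Independent S₁ l₁ → Independent S₂ l₂ → Independent S (l₁ ++ l₂)
          union (l₁∈ , ind₁) (l₂∈ , ind₂) =
            All.++⁺ (All.map (S₁⊑S _) l₁∈) (All.map (S₂⊑S _) l₂∈) ,
            AllPairs.++⁺ ind₁ ind₂ (All.map (λ x∈ → All.map (apart x∈) l₂∈) l₁∈)
          total : ∀ m₁ m₂ l₁ l₂ → m₁ + m₂ ≤ m → count S₁ ≤ length l₁ + m₁ + gap m₁ →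
            count S₂ ≤ length l₂ + m₂ + gap m₂ → count S ≤ length (l₁ ++ l₂) + m + gap m
          total m₁ m₂ l₁ l₂ m₁+m₂≤m c₁≤ c₂≤ = begin
            count S
              ≡⟨ count-sum ⟩
            count S₁ + count S₂
              ≤⟨ +-mono-≤ c₁≤ c₂≤ ⟩
            length l₁ + m₁ + gap m₁ + (length l₂ + m₂ + gap m₂)
              ≡⟨ regroup (length l₁) m₁ (gap m₁) (length l₂) m₂ (gap m₂) ⟩
            length l₁ + length l₂ + (m₁ + m₂) + (gap m₁ + gap m₂)
              ≤⟨ +-mono-≤ (+-monoʳ-≤ (length l₁ + length l₂) m₁+m₂≤m) gaps ⟩
            length l₁ + length l₂ + m + gap m
              ≡⟨ cong (λ a → a + m + gap m) (sym (length-++ l₁)) ⟩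
            length (l₁ ++ l₂) + m + gap m ∎
            where
            open ≤-Reasoning
            regroup : ∀ a m g b n h → a + m + g + (b + n + h) ≡ a + b + (m + n) + (g + h)
            regroup = solve-∀
            gaps : gap m₁ + gap m₂ ≤ gap m
            gaps = ≤-trans (gap-+ (<21 (≤-trans (m+n≤o⇒m≤o m₁ m₁+m₂≤m) m≤K))
                (m+n≤o⇒m≤o∸n (suc m₂) (subst (_≤ 21) (cong suc (+-comm m₁ m₂)) (<21 (≤-trans m₁+m₂≤m m≤K)))))
              (gap-mono m₁+m₂≤m (<21 m≤K))

-- Colourings and cliques

All-lookup : ∀ {A : Set} {P : A → Set} {l} → All P l → ∀ i → P (lookup l i)
All-lookup ps i = All.lookup ps (∈-lookup i)

AllPairs-lookup : ∀ {A : Set} {R : A → A → Set} {l} → AllPairs R l → ∀ i j → i ≢ j →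
  R (lookup l i) (lookup l j) ⊎ R (lookup l j) (lookup l i)
AllPairs-lookup (_ ∷ _)   zero    zero    i≢j = contradiction refl i≢j
AllPairs-lookup (rs ∷ _)  zero    (suc j) _   = inj₁ (All-lookup rs j)
AllPairs-lookup (rs ∷ _)  (suc i) zero    _   = inj₂ (All-lookup rs i)
AllPairs-lookup (_ ∷ ps)  (suc i) (suc j) i≢j = AllPairs-lookup ps i j (i≢j ∘ cong suc)

AllPairs-≢-injective : ∀ {A : Set} {l : List A} → AllPairs _≢_ l → ∀ {i j} → lookup l i ≡ lookup l j → i ≡ j
AllPairs-≢-injective ≢s {i} {j} e = decidable-stable (i ≟ j) λ i≢j → distinct (AllPairs-lookup ≢s i j i≢j)
  where
  distinct : _ ⊎ _ → ⊥
  distinct (inj₁ ≢) = ≢ e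
  distinct (inj₂ ≢) = ≢ (sym e)

==-sym : ∀ (x y : Fin n) → (x == y) ≡ (y == x)
==-sym x y with x ≟ y
... | yes refl = sym (==-refl x)
... | no x≢y   = sym (≢⇒==-false (x≢y ∘ sym))

module Complement (G : Graph n) where

  nonadj : Fin n → Fin n → Bool
  nonadj x y = not (x == y) ∧ not (adj G x y)

  nonadj-sym : ∀ x y → nonadj x y ≡ nonadj y x
  nonadj-sym x y = cong₂ (λ a b → not a ∧ not b) (==-sym x y) (adj-sym G x y)

  nonadj-irrefl : ∀ x → nonadj x x ≡ false
  nonadj-irrefl x rewrite ==-refl x = refl

  open Edges nonadj nonadj-sym nonadj-irrefl public
  open Matchings nonadj nonadj-sym nonadj-irrefl public
  open Extremal nonadj nonadj-sym nonadj-irrefl public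

  nonadj⇒ : ∀ {x y} → nonadj x y ≡ true → adj G x y ≡ false
  nonadj⇒ {x} {y} p with x == y | adj G x y
  ... | false | false = refl

  ⇒nonadj : ∀ {x y} → x ≢ y → adj G x y ≡ false → nonadj x y ≡ true
  ⇒nonadj x≢y e rewrite ≢⇒==-false x≢y | e = refl

  ¬nonadj⇒ : ∀ {x y} → x ≢ y → nonadj x y ≡ false → adj G x y ≡ true
  ¬nonadj⇒ {x} {y} x≢y p rewrite ≢⇒==-false x≢y with adj G x y
  ... | true = refl

  adj⇒¬nonadj : ∀ {x y} → adj G x y ≡ true → nonadj x y ≡ false
  adj⇒¬nonadj {x} {y} e rewrite e with x == y
  ... | true  = refl
  ... | false = refl

  Colourable : Sub n → ℕ → Set
  Colourable S c = Σ (Fin n → ℕ) λ f →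
    (∀ x → x ∈ S → f x < c) × (∀ x y → x ∈ S → y ∈ S → adj G x y ≡ true → f x ≢ f y)

  colourable-count : ∀ S {c} → count S ≤ c → Colourable S c
  colourable-count S count≤c with rank S
  ... | f , f< , inj = f , (λ x x∈S → <-≤-trans (f< x x∈S) count≤c) ,
        λ x y x∈S y∈S xy e → true≢false xy (subst (λ z → adj G x z ≡ false) (inj x y x∈S y∈S e) (adj-irrefl G x))

  -- The two ends of a matching edge are non-adjacent in `G` and can share a colour. `R` consists of
  -- the smaller end of each edge and the unmatched vertices of `S`; its `rank` gives the colours,
  -- `count S` minus `size M` in number.
  colourable-matching : ∀ {S c} (M : Matching S) → count S ≤ c + size M → Colourable S c
  colourable-matching {S} {c} M count≤ with rank R
    where
    R : Sub n
    R x = S x ∧ not (mate M x ≺ x)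
  ... | f , f< , inj = f ∘ rep , (λ x x∈S → <-≤-trans (f< (rep x) (rep∈ x x∈S)) count-R) , proper
    where
    R : Sub n
    R x = S x ∧ not (mate M x ≺ x)
    choose : Fin n → Bool → Fin n
    choose x true  = mate M x
    choose x false = x
    rep : Fin n → Fin n
    rep x = choose x (mate M x ≺ x)
    rep∈ : ∀ x → x ∈ S → rep x ∈ R
    rep∈ x x∈S with mate M x ≺ x in eq
    ... | false rewrite eq | x∈S = refl
    ... | true  rewrite involutive M x | ≮⇒⊀ (<⇒≯ (≺⇒< {x = mate M x} {x} eq))
      | mate-∈ M x (λ e → <-irrefl (cong toℕ e) (≺⇒< {x = mate M x} {x} eq)) = refl
    count-R : count R ≤ c
    count-R = +-cancelʳ-≤ (size M) (count R) c (begin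
      count R + size M             ≡⟨ cong (count R +_) (sym (descents≡ascents (mate M) (involutive M))) ⟩
      count R + descents (mate M)  ≡⟨ sym (∑-distrib-+ (λ x → ⟦ R x ⟧) (λ x → ⟦ mate M x ≺ x ⟧)) ⟩
      sum (λ x → ⟦ R x ⟧ + ⟦ mate M x ≺ x ⟧)   ≡⟨ sym (sum-cong-≗ pointwise) ⟩
      count S                      ≤⟨ count≤ ⟩
      c + size M                   ∎)
      where
      open ≤-Reasoning
      pointwise : ∀ x → ⟦ S x ⟧ ≡ ⟦ R x ⟧ + ⟦ mate M x ≺ x ⟧
      pointwise x with mate M x ≺ x in eq | S x in x∈S
      ... | true  | true  = refl
      ... | false | true  = refl
      ... | false | false = refl
      ... | true  | false = ⊥-elim (true≢false
            (proj₁ (edge M x (λ e → <-irrefl (cong toℕ e) (≺⇒< {x = mate M x} {x} eq)))) x∈S)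
    rep-cases : ∀ x → rep x ≡ x ⊎ rep x ≡ mate M x
    rep-cases x with mate M x ≺ x
    ... | true  = inj₂ refl
    ... | false = inj₁ refl
    same-rep : ∀ x y → rep x ≡ rep y → y ≡ x ⊎ y ≡ mate M x
    same-rep x y e with rep-cases x | rep-cases y
    ... | inj₁ p | inj₁ q = inj₁ (trans (sym q) (trans (sym e) p))
    ... | inj₂ p | inj₁ q = inj₂ (trans (sym q) (trans (sym e) p))
    ... | inj₁ p | inj₂ q = inj₂ (trans (sym (involutive M y)) (cong (mate M) (trans (sym q) (trans (sym e) p))))
    ... | inj₂ p | inj₂ q = inj₁ (trans (sym (involutive M y))
          (trans (cong (mate M) (trans (sym q) (trans (sym e) p))) (involutive M x)))
    proper : ∀ x y → x ∈ S → y ∈ S → adj G x y ≡ true → f (rep x) ≢ f (rep y)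
    proper x y x∈S y∈S xy e with same-rep x y (inj (rep x) (rep y) (rep∈ x x∈S) (rep∈ y y∈S) e)
    ... | inj₁ refl = true≢false xy (adj-irrefl G x)
    ... | inj₂ refl with mate M x ≟ x
    ...   | yes free  = true≢false xy (trans (cong (adj G x) free) (adj-irrefl G x))
    ...   | no moved  = true≢false xy (nonadj⇒ (proj₂ (edge M x moved)))

  Triangle : Sub n → Set
  Triangle S = ∃[ a ] ∃[ b ] ∃[ d ] (a ∈ S × b ∈ S × d ∈ S) ×
    (nonadj a b ≡ true × nonadj b d ≡ true × nonadj a d ≡ true)

  module RemoveTriple (S : Sub n) {a b d : Fin n} (a∈S : a ∈ S) (b∈S : b ∈ S) (d∈S : d ∈ S)
    (ab : nonadj a b ≡ true) (bd : nonadj b d ≡ true) (ad : nonadj a d ≡ true) where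

    rest : Sub n
    rest = ((S ∖ a) ∖ b) ∖ d

    rest-⊑ : rest ⊑ S
    rest-⊑ x = ∖-⊑ S a x ∘ ∖-⊑ (S ∖ a) b x ∘ ∖-⊑ ((S ∖ a) ∖ b) d x

    count-rest : count S ≡ 3 + count rest
    count-rest = trans (count-∖ S a∈S) (cong suc (trans (count-∖ (S ∖ a) b∈) (cong suc (count-∖ ((S ∖ a) ∖ b) d∈))))
      where
      b∈ : b ∈ (S ∖ a)
      b∈ = ∈-∖ S b∈S (h⇒≢ ab ∘ sym)
      d∈ : d ∈ ((S ∖ a) ∖ b)
      d∈ = ∈-∖ (S ∖ a) (∈-∖ S d∈S (h⇒≢ ad ∘ sym)) (h⇒≢ bd ∘ sym)

    private
      removed : ∀ x → x ∈ S → rest x ≡ false → x ≡ a ⊎ x ≡ b ⊎ x ≡ d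
      removed x x∈S x∉ with x ≟ a | x ≟ b | x ≟ d
      ... | yes e | _     | _     = inj₁ e
      ... | no _  | yes e | _     = inj₂ (inj₁ e)
      ... | no _  | no _  | yes e = inj₂ (inj₂ e)
      ... | no _  | no _  | no _  rewrite x∈S = contradiction x∉ λ ()

      independent : ∀ x y → x ≡ a ⊎ x ≡ b ⊎ x ≡ d → y ≡ a ⊎ y ≡ b ⊎ y ≡ d → adj G x y ≡ false
      independent x y (inj₁ refl)        (inj₁ refl)        = adj-irrefl G x
      independent x y (inj₁ refl)        (inj₂ (inj₁ refl)) = nonadj⇒ ab
      independent x y (inj₁ refl)        (inj₂ (inj₂ refl)) = nonadj⇒ ad
      independent x y (inj₂ (inj₁ refl)) (inj₁ refl)        = trans (adj-sym G x y) (nonadj⇒ ab)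
      independent x y (inj₂ (inj₁ refl)) (inj₂ (inj₁ refl)) = adj-irrefl G x
      independent x y (inj₂ (inj₁ refl)) (inj₂ (inj₂ refl)) = nonadj⇒ bd
      independent x y (inj₂ (inj₂ refl)) (inj₁ refl)        = trans (adj-sym G x y) (nonadj⇒ ad)
      independent x y (inj₂ (inj₂ refl)) (inj₂ (inj₁ refl)) = trans (adj-sym G x y) (nonadj⇒ bd)
      independent x y (inj₂ (inj₂ refl)) (inj₂ (inj₂ refl)) = adj-irrefl G x

    -- The triple is independent in `G` and receives the new colour `c`.
    extend-colouring : ∀ {c} → Colourable rest c → Colourable S (suc c)
    extend-colouring {c} (f , f< , proper) = g , g< , g-proper
      where
      g : Fin n → ℕ
      g x = if rest x then f x else c
      g< : ∀ x → x ∈ S → g x < suc c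
      g< x _ with rest x in eq
      ... | true  = m<n⇒m<1+n (f< x eq)
      ... | false = ≤-refl
      g-proper : ∀ x y → x ∈ S → y ∈ S → adj G x y ≡ true → g x ≢ g y
      g-proper x y x∈S y∈S xy e with rest x in x∈ | rest y in y∈
      ... | true  | true  = proper x y x∈ y∈ xy e
      ... | true  | false = <⇒≢ (f< x x∈) e
      ... | false | true  = <⇒≢ (f< y y∈) (sym e)
      ... | false | false = true≢false xy (independent x y (removed x x∈S x∈) (removed y y∈S y∈))

  -- `Independent` refers to `nonadj`, so `l` is a clique of `G`.
  LargeClique : Sub n → ℕ → ℕ → Set
  LargeClique S c m = ∃[ l ] Independent S l × suc c ≤ length l + gap m

  module _ {K : ℕ} (K<21 : K < 21) (small : ∀ m → m ≤ K → ∀ S → TriangleFree S → count S ≡ suc (2 * m) →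
      ¬ AllIndependent< S (suc (m ∸ gap m))) where

    -- As χ ≥ c + 1, `m` is an upper bound for |S| - χ. An independent triple, if there is one, is
    -- deleted in `triple-case`. Otherwise the complement is triangle-free, and a matching with more
    -- than `m′` edges would yield a colouring with `c` colours.
    large-clique : ∀ m → m ≤ K → ∀ S c → ¬ Colourable S c → count S ≤ suc c + m → ¬ ¬ LargeClique S c m
    triple-case : ∀ m → m ≤ K → ∀ S c → ¬ Colourable S c → count S ≤ suc c + m → Triangle S → ¬ ¬ LargeClique S c m

    large-clique m m≤K S c ¬col count≤ k = ¬¬-excluded-middle {A = Triangle S} λ
      { (yes triangle) → triple-case m m≤K S c ¬col count≤ triangle k
      ; (no ¬triangle) → independent-of-matching K<21 small (count S) m′ m′≤K S ≤-refl
          (λ x y z x∈ y∈ z∈ xy yz xz → ¬triangle (x , y , z , (x∈ , y∈ , z∈) , (xy , yz , xz)))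
          matching≤
          λ (l , ind , c≤) → k (l , ind , clique-size l c≤) }
      where
      m′ : ℕ
      m′ = count S ∸ suc c
      c<count : suc c ≤ count S
      c<count = ≰⇒> (¬col ∘ colourable-count S)
      count≡ : count S ≡ suc c + m′
      count≡ = sym (m+[n∸m]≡n c<count)
      m′≤m : m′ ≤ m
      m′≤m = m≤n+o⇒m∸n≤o (count S) (suc c) count≤
      m′≤K : m′ ≤ K
      m′≤K = ≤-trans m′≤m m≤K
      matching≤ : ∀ (M : Matching S) → size M ≤ m′
      matching≤ M = decidable-stable (size M ≤? m′) λ ≰ → ¬col (colourable-matching M (begin
        count S        ≡⟨ count≡ ⟩
        suc c + m′     ≡⟨ sym (+-suc c m′) ⟩
        c + suc m′     ≤⟨ +-monoʳ-≤ c (≰⇒> ≰) ⟩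
        c + size M     ∎))
        where open ≤-Reasoning
      clique-size : ∀ l → count S ≤ length l + m′ + gap m′ → suc c ≤ length l + gap m
      clique-size l c≤ = +-cancelʳ-≤ m′ (suc c) (length l + gap m) (begin
        suc c + m′                 ≡⟨ sym count≡ ⟩
        count S                    ≤⟨ c≤ ⟩
        length l + m′ + gap m′     ≤⟨ +-monoʳ-≤ (length l + m′) (gap-mono m′≤m (≤-<-trans m≤K K<21)) ⟩
        length l + m′ + gap m      ≡⟨ swap (length l) m′ (gap m) ⟩
        length l + gap m + m′      ∎)
        where
        open ≤-Reasoning
        swap : ∀ a b g → a + b + g ≡ a + g + b
        swap = solve-∀

    -- A single vertex is already a clique of the required size.
    triple-case m m≤K S zero ¬col count≤ (a , b , d , (a∈ , b∈ , d∈) , _) k =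
      k (a ∷ [] , (a∈ ∷ [] , [] ∷ []) , s≤s z≤n)
    -- For `m` equal to 0 or 1 at most `c` vertices remain; they get distinct colours and the triple
    -- takes the last one.
    triple-case zero m≤K S (suc c) ¬col count≤ (a , b , d , (a∈ , b∈ , d∈) , (ab , bd , ad)) k =
      ¬col (extend-colouring (colourable-count rest (shrink (subst (_≤ suc (suc c) + 0) count-rest count≤))))
      where
      open RemoveTriple S a∈ b∈ d∈ ab bd ad
      shrink : 3 + count rest ≤ suc (suc c) + 0 → count rest ≤ c
      shrink (s≤s (s≤s p)) = ≤-trans (n≤1+n (count rest)) (subst (suc (count rest) ≤_) (+-identityʳ c) p)
    triple-case (suc zero) m≤K S (suc c) ¬col count≤ (a , b , d , (a∈ , b∈ , d∈) , (ab , bd , ad)) k =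
      ¬col (extend-colouring (colourable-count rest (shrink (subst (_≤ suc (suc c) + 1) count-rest count≤))))
      where
      open RemoveTriple S a∈ b∈ d∈ ab bd ad
      shrink : 3 + count rest ≤ suc (suc c) + 1 → count rest ≤ c
      shrink (s≤s (s≤s p)) = ≤-pred (subst (suc (count rest) ≤_) (+-comm c 1) p)
    triple-case (suc (suc m)) m≤K S (suc c) ¬col count≤ (a , b , d , (a∈ , b∈ , d∈) , (ab , bd , ad)) k =
      large-clique m (≤-trans (m≤n+m m 2) m≤K) rest c (¬col ∘ extend-colouring)
        (shrink (subst (_≤ suc (suc c) + suc (suc m)) count-rest count≤))
        λ (l , ind , c≤) → k (l , Independent-⊑ rest-⊑ ind , (begin
          suc (suc c)                  ≤⟨ s≤s c≤ ⟩
          suc (length l + gap m)       ≡⟨ sym (+-suc (length l) (gap m)) ⟩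
          length l + suc (gap m)       ≤⟨ +-monoʳ-≤ (length l) (gap-2+ (≤-pred (≤-pred (≤-<-trans m≤K K<21)))) ⟩
          length l + gap (2 + m)       ∎))
      where
      open ≤-Reasoning
      open RemoveTriple S a∈ b∈ d∈ ab bd ad
      shrink : 3 + count rest ≤ suc (suc c) + suc (suc m) → count rest ≤ suc c + m
      shrink (s≤s (s≤s p)) = ≤-pred (subst (suc (count rest) ≤_)
        (trans (+-suc c (suc m)) (cong suc (+-suc c m))) p)

  hasClique : ∀ {S l q} → Independent S l → q ≤ length l → HasClique G q
  hasClique {S} {l} {q} (_ , pairwise) q≤ = (λ i → lookup l (inject≤ i q≤)) ,
    (λ e → inject≤-injective q≤ q≤ _ _ (AllPairs-≢-injective (AllPairs.map proj₁ pairwise) e)) ,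
    λ i j i≢j → adjacent (AllPairs-lookup pairwise (inject≤ i q≤) (inject≤ j q≤) (i≢j ∘ inject≤-injective q≤ q≤ i j))
    where
    adjacent : ∀ {x y} → (x ≢ y × nonadj x y ≡ false) ⊎ (y ≢ x × nonadj y x ≡ false) → adj G x y ≡ true
    adjacent         (inj₁ (x≢y , e)) = ¬nonadj⇒ x≢y e
    adjacent {x} {y} (inj₂ (y≢x , e)) = trans (adj-sym G x y) (¬nonadj⇒ y≢x e)

  varrows⇒¬colourable : ∀ {r} → VArrows G r (twos r) → ¬ Colourable (λ _ → true) r
  varrows⇒¬colourable arrows (f , f< , proper) with arrows (λ x → fromℕ< (f< x refl))
  ... | i , g , (_ , clique) , mono = proper (g zero) (g (suc zero)) refl refl (clique zero (suc zero) λ ())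
    (trans (sym (toℕ-fromℕ< (f< (g zero) refl)))
      (trans (cong toℕ (trans (mono zero) (sym (mono (suc zero))))) (toℕ-fromℕ< (f< (g (suc zero)) refl))))

  small-19 : ∀ m → m ≤ 19 → ∀ S → TriangleFree S → count S ≡ suc (2 * m) → ¬ AllIndependent< S (suc (m ∸ gap m))
  small-19 m m≤19 S tf odd = ramsey (m ∸ gap m) S
    (subst (λ s → s * (m ∸ gap m) < volumeBound (suc (m ∸ gap m)) s) (sym odd) (gap-ramsey (s≤s m≤19))) tf
    where open EdgeBounds nonadj nonadj-sym nonadj-irrefl

  -- At m = 20 there are 41 vertices and `m ∸ gap m` is 9. The hypothesis on R(10,3), applied to the
  -- induced subgraph of `G`, gives a 10-clique, which is too large a `nonadj`-independent set, or
  -- an independent triple, which is a triangle of `nonadj`.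
  small-20 : RamseyLe 10 41 → ∀ m → m ≤ 20 → ∀ S → TriangleFree S → count S ≡ suc (2 * m) →
    ¬ AllIndependent< S (suc (m ∸ gap m))
  small-20 R[10,3]≤41 m m≤20 S tf odd small with m≤n⇒m<n∨m≡n m≤20
  ... | inj₁ m<20 = small-19 m (≤-pred m<20) S tf odd small
  ... | inj₂ refl with elements S
  ...   | l , len , l∈ , l≢ with R[10,3]≤41 (length l) (≤-reflexive (sym (trans len odd))) H
    where
    H : Graph (length l)
    H = record { adj = λ i j → adj G (lookup l i) (lookup l j)
               ; adj-sym = λ i j → adj-sym G (lookup l i) (lookup l j)
               ; adj-irrefl = λ i → adj-irrefl G (lookup l i) }
  ...     | inj₁ (f , inj , clique) = <-irrefl (length-tabulate (lookup l ∘ f)) (small (tabulate (lookup l ∘ f))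
    (All.tabulate⁺ (λ i → All-lookup l∈ (f i)) ,
     AllPairs.tabulate⁺ λ {i} {j} i≢j → (λ e → i≢j (inj (AllPairs-≢-injective l≢ e))) , adj⇒¬nonadj (clique i j i≢j)))
  ...     | inj₂ (f , inj , indep) = tf (v zero) (v (suc zero)) (v (suc (suc zero)))
    (All-lookup l∈ (f zero)) (All-lookup l∈ (f (suc zero))) (All-lookup l∈ (f (suc (suc zero))))
    (nonadjacent zero (suc zero) λ ()) (nonadjacent (suc zero) (suc (suc zero)) λ ())
    (nonadjacent zero (suc (suc zero)) λ ())
    where
    v : Fin 3 → Fin n
    v = lookup l ∘ f
    nonadjacent : ∀ i j → i ≢ j → nonadj (v i) (v j) ≡ true
    nonadjacent i j i≢j = ⇒nonadj (λ e → i≢j (inj (AllPairs-≢-injective l≢ e))) (indep i j i≢j)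

  -- With at most `suc r + K` vertices, `large-clique` for `c = r` would give a clique on at least r
  -- + 1 - 11 = r - 10 vertices.
  order-bound : ∀ {K} → K < 21 → (∀ m → m ≤ K → ∀ S → TriangleFree S → count S ≡ suc (2 * m) →
    ¬ AllIndependent< S (suc (m ∸ gap m))) → gap K ≡ 11 → ∀ {r} → InHv G r (twos r) (r ∸ 10) → suc r + K < n
  order-bound {K} K<21 small gap≡11 {r} (arrows , ¬clique) = decidable-stable (suc r + K <? n) λ ≮ →
    large-clique K<21 small K ≤-refl (λ _ → true) r (varrows⇒¬colourable arrows)
      (subst (_≤ suc r + K) (sym (count-full n)) (≮⇒≥ ≮))
      λ (l , ind , r<) → ¬clique (hasClique ind (m≤n+o⇒m∸n≤o r 10 (≤-pred
        (subst (suc r ≤_) (trans (cong (length l +_) gap≡11) (+-comm (length l) 11)) r<))))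

-- A Ramsey graph on 43 vertices

-- The differences ±18·{1, 4, 6, 9, 20} modulo 43; the multiplier 18 only serves to shorten the search below.
chord : ℕ → Bool
chord d = any (d ≡ᵇ_) (10 ∷ 14 ∷ 16 ∷ 18 ∷ 21 ∷ 22 ∷ 25 ∷ 27 ∷ 29 ∷ 33 ∷ [])

-- One of the truncated differences is zero, so their sum is the distance. The list in `chord` is
-- closed under replacing d by 43 - d, so distances decide adjacency modulo 43.
joined : ℕ → ℕ → Bool
joined v w = chord ((v ∸ w) + (w ∸ v))

-- Branch and bound for independent sets inside `l`: take `v` and discard its neighbours, or drop
-- `v`, and stop once too few vertices remain. `fuel` makes the recursion structural across
-- `filterᵇ`; the length of `l` is enough, since each call removes a vertex.
boundedBy : ℕ → ℕ → List ℕ → Bool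
boundedBy fuel       k       []      = true
boundedBy fuel       zero    (v ∷ l) = false
boundedBy zero       (suc k) (v ∷ l) = false
boundedBy (suc fuel) (suc k) (v ∷ l) =
  (length l ≤ᵇ k) ∨ (boundedBy fuel k (filterᵇ (not ∘ joined v) l) ∧ boundedBy fuel (suc k) l)

everyᵇ : ∀ {n} → (Fin n → Bool) → Bool
everyᵇ {zero}  P = true
everyᵇ {suc n} P = P zero ∧ everyᵇ (P ∘ suc)

everyᵇ-sound : ∀ {n} (P : Fin n → Bool) → everyᵇ P ≡ true → ∀ i → P i ≡ true
everyᵇ-sound P e zero    = proj₁ (∧-true e)
everyᵇ-sound P e (suc i) = everyᵇ-sound (P ∘ suc) (proj₂ (∧-true {P zero} e)) i

countᴸ : (ℕ → Bool) → List ℕ → ℕ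
countᴸ T []      = 0
countᴸ T (x ∷ l) = ⟦ T x ⟧ + countᴸ T l

countᴸ≤length : ∀ T l → countᴸ T l ≤ length l
countᴸ≤length T []      = z≤n
countᴸ≤length T (x ∷ l) with T x
... | true  = s≤s (countᴸ≤length T l)
... | false = m≤n⇒m≤1+n (countᴸ≤length T l)

countᴸ-filter : ∀ T P l → (∀ x → T x ≡ true → P x ≡ true) → countᴸ T l ≤ countᴸ T (filterᵇ P l)
countᴸ-filter T P []      T⊑P = z≤n
countᴸ-filter T P (x ∷ l) T⊑P with T x in x∈ | P x in px
... | true  | true  rewrite x∈ = s≤s (countᴸ-filter T P l T⊑P)
... | true  | false = contradiction (trans (sym (T⊑P x x∈)) px) λ ()
... | false | true  rewrite x∈ = countᴸ-filter T P l T⊑P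
... | false | false = countᴸ-filter T P l T⊑P

boundedBy-sound : ∀ T → (∀ x y → T x ≡ true → T y ≡ true → joined x y ≡ false) →
  ∀ fuel k l → boundedBy fuel k l ≡ true → countᴸ T l ≤ k
boundedBy-sound T ind fuel       k       []      e = z≤n
boundedBy-sound T ind (suc fuel) (suc k) (v ∷ l) e with length l ≤ᵇ k in short
... | true  = ≤-trans (countᴸ≤length T (v ∷ l)) (s≤s (≤ᵇ⇒≤ (length l) k (Equivalence.from T-≡ short)))
... | false with ∧-true e
...   | with-v , without-v with T v in v∈
...     | true  = s≤s (≤-trans (countᴸ-filter T (not ∘ joined v) l (λ x x∈ → cong not (ind v x v∈ x∈)))
                    (boundedBy-sound T ind fuel k (filterᵇ (not ∘ joined v) l) with-v))
...     | false = boundedBy-sound T ind fuel (suc k) l without-v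

countᴸ-upTo : ∀ (T : ℕ → Bool) n → count (λ (x : Fin n) → T (toℕ x)) ≡ countᴸ T (upTo n)
countᴸ-upTo T n = go n id
  where
  go : ∀ n f → count (λ (x : Fin n) → T (f (toℕ x))) ≡ countᴸ T (applyUpTo f n)
  go zero    f = refl
  go (suc n) f = cong (⟦ T (f 0) ⟧ +_) (go n (f ∘ suc))

length≤count : ∀ {n} (S : Sub n) l → All (_∈ S) l → AllPairs _≢_ l → length l ≤ count S
length≤count S []      _          _          = z≤n
length≤count S (x ∷ l) (x∈ ∷ l∈) (x≢ ∷ l≢) = subst (suc (length l) ≤_) (sym (count-∖ S x∈))
  (s≤s (length≤count (S ∖ x) l (All.zipWith (λ (y∈ , x≢y) → ∈-∖ S y∈ (x≢y ∘ sym)) (l∈ , x≢)) l≢))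

joined-sym : ∀ v w → joined v w ≡ joined w v
joined-sym v w = cong chord (+-comm (v ∸ w) (w ∸ v))

-- Adjacency is complementary to `joined`: cliques here are the independent sets of the circulant
-- graph, and independent triples are its triangles.
circulant : Graph 43
circulant = record
  { adj        = λ i j → not (i == j) ∧ not (joined (toℕ i) (toℕ j))
  ; adj-sym    = λ i j → cong₂ (λ a b → not a ∧ not b) (==-sym i j) (joined-sym (toℕ i) (toℕ j))
  ; adj-irrefl = λ i → cong (λ b → not b ∧ not (joined (toℕ i) (toℕ i))) (==-refl i) }

circulant-clique : ¬ HasClique circulant 11
circulant-clique (f , inj , clique) = <⇒≱ (n<1+n 10) (begin
  11                                ≡⟨ sym (length-tabulate f) ⟩
  length (tabulate f)               ≤⟨ length≤count {43} (member ∘ toℕ) (tabulate f) (All.tabulate⁺ chosen)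
                                         (AllPairs.tabulate⁺ (λ i≢j e → i≢j (inj e))) ⟩
  count {43} (member ∘ toℕ)                 ≡⟨ countᴸ-upTo member 43 ⟩
  -- `refl` runs the whole search on the 43 residues.
  countᴸ member (upTo 43)                ≤⟨ boundedBy-sound member independent 43 10 (upTo 43) refl ⟩
  10                                ∎)
  where
  open ≤-Reasoning
  chosen? : ∀ x → Dec (∃[ i ] toℕ (f i) ≡ x)
  chosen? x = any? (λ i → toℕ (f i) ≟ᴺ x)
  member : ℕ → Bool
  member x = does (chosen? x)
  chosen : ∀ i → member (toℕ (f i)) ≡ true
  chosen i = dec-true (chosen? (toℕ (f i))) (i , refl)
  preimage : ∀ {x} → member x ≡ true → ∃[ i ] toℕ (f i) ≡ x
  preimage {x} e = invert (subst (Reflects _) e (proof (chosen? x)))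
  independent : ∀ x y → member x ≡ true → member y ≡ true → joined x y ≡ false
  independent x y x∈ y∈ with preimage x∈ | preimage y∈
  ... | i , refl | j , refl with i ≟ j
  ...   | yes refl = cong chord (cong₂ _+_ (n∸n≡0 (toℕ (f i))) (n∸n≡0 (toℕ (f i))))
  ...   | no i≢j = not-injective (proj₂ (∧-true {not (f i == f j)} (clique i j i≢j)))

circulant-indep : ¬ HasIndep circulant 3
circulant-indep (f , inj , indep) = true≢false (triangle-free (f zero) (f (suc zero)) (f (suc (suc zero))))
  (cong not (cong₂ _∧_ (edge zero (suc zero) λ ())
    (cong₂ _∧_ (edge (suc zero) (suc (suc zero)) λ ()) (edge zero (suc (suc zero)) λ ()))))
  where
  apart : Fin 43 → Fin 43 → Fin 43 → Bool
  apart i j k = not (joined (toℕ i) (toℕ j) ∧ (joined (toℕ j) (toℕ k) ∧ joined (toℕ i) (toℕ k)))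
  triangle-free : ∀ i j k → apart i j k ≡ true
  -- `refl` evaluates the Boolean check over all 43³ triples.
  triangle-free i j = everyᵇ-sound (apart i j) (everyᵇ-sound (λ j → everyᵇ (apart i j))
    (everyᵇ-sound (λ i → everyᵇ (λ j → everyᵇ (apart i j))) refl i) j)
  edge : ∀ i j → i ≢ j → joined (toℕ (f i)) (toℕ (f j)) ≡ true
  edge i j i≢j with indep i j i≢j
  ... | e rewrite ≢⇒==-false (i≢j ∘ inj) = not-injective e

-- Upper bounds

-- Without a monochromatic edge every colour class is independent, so it has at most two vertices.
many-vertices⇒arrows : ∀ {r} (G : Graph n) → ¬ HasIndep G 3 → 2 * r < n → VArrows G r (twos r)
many-vertices⇒arrows {n} {r} G ¬indep 2r<n c
  with any? (λ i → any? (λ j → (c i ≟ c j) ×-dec (adj G i j ≟ᴮ true)))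
... | yes (i , j , cij , ij) = c i , f , (f-inj , f-clique) , mono
  where
  f : Fin 2 → Fin n
  f zero    = i
  f (suc _) = j
  i≢j : i ≢ j
  i≢j refl = true≢false ij (adj-irrefl G i)
  f-inj : Injective _≡_ _≡_ f
  f-inj {zero}     {zero}     _ = refl
  f-inj {zero}     {suc zero} e = contradiction e i≢j
  f-inj {suc zero} {zero}     e = contradiction (sym e) i≢j
  f-inj {suc zero} {suc zero} _ = refl
  f-clique : ∀ a b → a ≢ b → adj G (f a) (f b) ≡ true
  f-clique zero       zero       a≢b = contradiction refl a≢b
  f-clique zero       (suc zero) _   = ij
  f-clique (suc zero) zero       _   = trans (adj-sym G j i) ij
  f-clique (suc zero) (suc zero) a≢b = contradiction refl a≢b
  mono : ∀ x → c (f x) ≡ c i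
  mono zero    = refl
  mono (suc _) = sym cij
... | no proper = contradiction 2r<n (≤⇒≯ (begin
  n                                                ≡⟨ sym (count-full n) ⟩
  sum {n} (λ _ → 1)                                ≡⟨ sym (sum-cong-≗ (λ x → count-singleton (c x))) ⟩
  sum (λ x → sum (λ k → ⟦ k == c x ⟧))             ≡⟨ ∑-comm (λ x k → ⟦ k == c x ⟧) ⟩
  sum (λ k → count (class k))                      ≤⟨ sum-mono class≤2 ⟩
  sum {r} (λ _ → 2)                                ≡⟨ sum-const r 2 ⟩
  r * 2                                            ≡⟨ *-comm r 2 ⟩
  2 * r                                            ∎))
  where
  open ≤-Reasoning
  class : Fin r → Sub n
  class k x = k == c x
  class≤2 : ∀ k → count (class k) ≤ 2
  class≤2 k = decidable-stable (count (class k) ≤? 2) λ ≰2 → ¬indep (indep (≰⇒> ≰2))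
    where
    indep : 3 ≤ count (class k) → HasIndep G 3
    indep 3≤ with elements (class k)
    ... | l , len , l∈ , l≢ = lookup l ∘ at3 , (λ e → inject≤-injective 3≤len 3≤len _ _ (AllPairs-≢-injective l≢ e)) ,
        λ i j _ → ¬-not (λ ij → proper (lookup l (at3 i) , lookup l (at3 j) ,
          trans (sym (coloured i)) (coloured j) , ij))
      where
      3≤len : 3 ≤ length l
      3≤len = subst (3 ≤_) (sym len) 3≤
      at3 : Fin 3 → Fin (length l)
      at3 i = inject≤ i 3≤len
      coloured : ∀ i → k ≡ c (lookup l (at3 i))
      coloured i = ==⇒≡ {x = k} (All-lookup l∈ (at3 i))

cone : Graph n → Graph (suc n)
cone {n} G = record { adj = adj′ ; adj-sym = adj′-sym ; adj-irrefl = adj′-irrefl }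
  where
  adj′ : Fin (suc n) → Fin (suc n) → Bool
  adj′ zero    zero    = false
  adj′ zero    (suc j) = true
  adj′ (suc i) zero    = true
  adj′ (suc i) (suc j) = adj G i j
  adj′-sym : ∀ i j → adj′ i j ≡ adj′ j i
  adj′-sym zero    zero    = refl
  adj′-sym zero    (suc j) = refl
  adj′-sym (suc i) zero    = refl
  adj′-sym (suc i) (suc j) = adj-sym G i j
  adj′-irrefl : ∀ i → adj′ i i ≡ false
  adj′-irrefl zero    = refl
  adj′-irrefl (suc i) = adj-irrefl G i

-- Either a vertex of `G` has the colour of the apex, giving a monochromatic edge, or `punchOut`
-- removes that colour and `G` is coloured with the other `r`.
cone-arrows : ∀ {r} (G : Graph n) → VArrows G r (twos r) → VArrows (cone G) (suc r) (twos (suc r))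
cone-arrows {n} {r} G arrows c with any? (λ x → c (suc x) ≟ c zero)
... | yes (x , cx) = c zero , f , (f-inj , f-clique) , mono
  where
  f : Fin 2 → Fin (suc n)
  f zero    = zero
  f (suc _) = suc x
  f-inj : Injective _≡_ _≡_ f
  f-inj {zero}     {zero}     _ = refl
  f-inj {suc zero} {suc zero} _ = refl
  f-clique : ∀ a b → a ≢ b → adj (cone G) (f a) (f b) ≡ true
  f-clique zero       zero       a≢b = contradiction refl a≢b
  f-clique zero       (suc zero) _   = refl
  f-clique (suc zero) zero       _   = refl
  f-clique (suc zero) (suc zero) a≢b = contradiction refl a≢b
  mono : ∀ a → c (f a) ≡ c zero
  mono zero    = refl
  mono (suc _) = cx
... | no unused with arrows (λ x → punchOut (apex≢ x))
  where
  apex≢ : ∀ x → c zero ≢ c (suc x)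
  apex≢ x e = unused (x , sym e)
...   | i , f , (f-inj , f-clique) , mono = punchIn (c zero) i , suc ∘ f , (f-inj ∘ suc-injective , f-clique) ,
  λ a → trans (sym (punchIn-punchOut _)) (cong (punchIn (c zero)) (mono a))

-- One vertex of the clique is dropped, the apex if it occurs and the first vertex otherwise;
-- `avoid` carries the other `q` over to `G`.
cone-clique : ∀ {q} (G : Graph n) → ¬ HasClique G q → ¬ HasClique (cone G) (suc q)
cone-clique {q = q} G ¬clique (f , f-inj , f-clique) = case (any? (λ i → f i ≟ zero))
  where
  avoid : (e : Fin q → Fin (suc q)) → Injective _≡_ _≡_ e → (∀ j → zero ≢ f (e j)) → ⊥
  avoid e e-inj ≢zero = ¬clique ((λ j → punchOut (≢zero j)) ,
    (λ {a} {b} p → e-inj (f-inj (punchOut-injective (≢zero a) (≢zero b) p))) ,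
    λ a b a≢b → subst₂ (λ x y → adj (cone G) x y ≡ true) (sym (punchIn-punchOut (≢zero a)))
      (sym (punchIn-punchOut (≢zero b))) (f-clique (e a) (e b) (a≢b ∘ e-inj)))
  case : Dec (∃[ i ] f i ≡ zero) → ⊥
  case (yes (i , fi)) = avoid (punchIn i) (λ {a} {b} → punchIn-injective i a b)
    (λ j e → punchInᵢ≢i i j (f-inj (trans (sym e) (sym fi))))
  case (no ≢zero)     = avoid suc suc-injective (λ j e → ≢zero (suc j , sym e))

iterated-cone : ∀ {r q} k → (Σ (Graph n) λ G → InHv G r (twos r) q) →
  Σ (Graph (k + n)) λ G → InHv G (k + r) (twos (k + r)) (k + q)
iterated-cone zero    G = G
iterated-cone (suc k) G with iterated-cone k G
... | H , arrows , ¬clique = cone H , cone-arrows H arrows , cone-clique H ¬clique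

-- Exhaustive search for a Ramsey graph

Searchable : Set → Set₁
Searchable A = ∀ {P : A → Set} → (∀ x → Dec (P x)) → Dec (∃ P)

searchBool : Searchable Bool
searchBool P? = map′ (λ { (inj₁ p) → true , p ; (inj₂ p) → false , p })
  (λ { (true , p) → inj₁ p ; (false , p) → inj₂ p }) (P? true ⊎-dec P? false)

searchVec : ∀ {A} → Searchable A → ∀ k → Searchable (Vec A k)
searchVec search zero    P? = map′ ([] ,_) (λ { ([] , p) → p }) (P? [])
searchVec search (suc k) P? = map′ (λ (x , xs , p) → x ∷ xs , p) (λ { (x ∷ xs , p) → x , xs , p })
  (search (λ x → searchVec search k (λ xs → P? (x ∷ xs))))

-- IsClique and IsIndep are the cases b = true and b = false.
Homogeneous : ∀ {k} → Bool → (Fin n → Fin n → Bool) → (Fin k → Fin n) → Set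
Homogeneous b a f = Injective _≡_ _≡_ f × (∀ i j → i ≢ j → a (f i) (f j) ≡ b)

homogeneous? : ∀ b (a : Fin n → Fin n → Bool) k → Dec (Σ (Fin k → Fin n) (Homogeneous b a))
homogeneous? b a k = map′ (λ (v , p) → lookupⱽ v , p) (λ (f , p) → tabulateⱽ f , respect f p)
  (searchVec any? k λ v → injective? (lookupⱽ v) ×-dec
    all? (λ i → all? (λ j → ¬? (i ≟ j) →-dec (a (lookupⱽ v i) (lookupⱽ v j) ≟ᴮ b))))
  where
  injective? : ∀ f → Dec (Injective _≡_ _≡_ f)
  injective? f = map′ (λ p {i} {j} → p i j) (λ p i j → p {i} {j})
    (all? (λ i → all? (λ j → (f i ≟ f j) →-dec (i ≟ j))))
  respect : ∀ f → Homogeneous b a f → Homogeneous b a (lookupⱽ (tabulateⱽ f))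
  respect f (inj , hom) =
    (λ {i} {j} e → inj (trans (sym (lookup∘tabulate f i)) (trans e (lookup∘tabulate f j)))) ,
    λ i j i≢j → trans (cong₂ a (lookup∘tabulate f i) (lookup∘tabulate f j)) (hom i j i≢j)

-- Symmetrising and clearing the diagonal turns every Boolean matrix into a graph, so the search may
-- range over all matrices.
decode : Vec (Vec Bool n) n → Graph n
decode {n} v = record
  { adj        = λ i j → not (i == j) ∧ (entry i j ∨ entry j i)
  ; adj-sym    = λ i j → cong₂ (λ a b → not a ∧ b) (==-sym i j) (∨-comm (entry i j) (entry j i))
  ; adj-irrefl = λ i → cong (λ b → not b ∧ (entry i i ∨ entry i i)) (==-refl i) }
  where
  entry : Fin n → Fin n → Bool
  entry i j = lookupⱽ (lookupⱽ v i) j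

encode : Graph n → Vec (Vec Bool n) n
encode G = tabulateⱽ (λ i → tabulateⱽ (adj G i))

decode-encode : ∀ (G : Graph n) i j → adj (decode (encode G)) i j ≡ adj G i j
decode-encode G i j rewrite lookup∘tabulate (λ i → tabulateⱽ (adj G i)) i | lookup∘tabulate (adj G i) j
  | lookup∘tabulate (λ i → tabulateⱽ (adj G i)) j | lookup∘tabulate (adj G j) i | adj-sym G j i with i ≟ j
... | yes refl = sym (adj-irrefl G i)
... | no _     = ∨-idem (adj G i j)

-- A refuted universal statement gives no witness by itself, but the graphs on `m` vertices can be
-- searched. If none is good, `RamseyLe p m` follows, because a larger graph induces a graph on its
-- first `m` vertices.
¬RamseyLe⇒graph : ∀ {p m} → ¬ RamseyLe p m → Σ (Graph m) λ G → ¬ HasClique G p × ¬ HasIndep G 3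
¬RamseyLe⇒graph {p} {m} ¬ramsey = found (searchVec (searchVec searchBool m) m good?)
  where
  Good : Vec (Vec Bool m) m → Set
  Good v = ¬ HasClique (decode v) p × ¬ HasIndep (decode v) 3
  good? : ∀ v → Dec (Good v)
  good? v = ¬? (homogeneous? true (adj (decode v)) p) ×-dec ¬? (homogeneous? false (adj (decode v)) 3)
  found : Dec (∃ Good) → Σ (Graph m) λ G → ¬ HasClique G p × ¬ HasIndep G 3
  found (yes (v , good)) = decode v , good
  found (no none) = contradiction ramsey ¬ramsey
    where
    ramsey : RamseyLe p m
    ramsey n m≤n G = decide (homogeneous? true (adj H) p) (homogeneous? false (adj H) 3)
      where
      ι : Fin m → Fin n
      ι i = inject≤ i m≤n
      G′ : Graph m
      G′ = record { adj = λ i j → adj G (ι i) (ι j) ; adj-sym = λ i j → adj-sym G (ι i) (ι j)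
                  ; adj-irrefl = λ i → adj-irrefl G (ι i) }
      H : Graph m
      H = decode (encode G′)
      lift : ∀ {b k} → Σ (Fin k → Fin m) (Homogeneous b (adj H)) → Σ (Fin k → Fin n) (Homogeneous b (adj G))
      lift (f , inj , hom) = ι ∘ f , (λ e → inj (inject≤-injective m≤n m≤n _ _ e)) ,
        λ i j i≢j → trans (sym (decode-encode G′ (f i) (f j))) (hom i j i≢j)
      decide : Dec (HasClique H p) → Dec (HasIndep H 3) → HasClique G p ⊎ HasIndep G 3
      decide (yes clique) _           = inj₁ (lift clique)
      decide (no _)       (yes indep) = inj₂ (lift indep)
      decide (no ¬clique) (no ¬indep) = contradiction (encode G′ , ¬clique , ¬indep) none

-- Each of the `r ∸ r₀` universal vertices raises the order, the number of colours and the clique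
-- bound by one, so the differences `c` and 10 persist.
upper-bound : ∀ {m r₀ q₀ c} (G : Graph m) → ¬ HasClique G q₀ → ¬ HasIndep G 3 → 2 * r₀ < m →
  m ≡ r₀ + c → r₀ ≡ q₀ + 10 → ∀ r → r₀ ≤ r → Σ (Graph (r + c)) λ G → InHv G r (twos r) (r ∸ 10)
upper-bound {m} {r₀} {q₀} {c} G ¬clique ¬indep 2r₀<m m≡ r₀≡ r r₀≤r = subst₂ F r≡ q≡
  (subst (λ s → Σ (Graph s) λ H → InHv H (k + r₀) (twos (k + r₀)) (k + q₀)) size≡
    (iterated-cone k (G , many-vertices⇒arrows G ¬indep 2r₀<m , ¬clique)))
  where
  F : ℕ → ℕ → Set
  F s q = Σ (Graph (s + c)) λ H → InHv H s (twos s) q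
  k = r ∸ r₀
  r≡ : k + r₀ ≡ r
  r≡ = m∸n+n≡m r₀≤r
  size≡ : k + m ≡ k + r₀ + c
  size≡ = trans (cong (k +_) m≡) (sym (+-assoc k r₀ c))
  q≡ : k + q₀ ≡ r ∸ 10
  q≡ = sym (trans
    (cong (_∸ 10) (trans (sym r≡) (trans (cong (k +_) r₀≡) (sym (+-assoc k q₀ 10)))))
    (m+n∸n≡m (k + q₀) 10))

theorem1p3 : ∀ (r : ℕ) → 13 ≤ r →
    ( FvGe r (twos r) (r ∸ 10) (r + 21)
    × (¬ RamseyLe 10 41 → 20 ≤ r → FvEq r (twos r) (r ∸ 10) (r + 21)) )
    × ( RamseyLe 10 41 →
    FvGe r (twos r) (r ∸ 10) (r + 22)
    × (21 ≤ r → FvEq r (twos r) (r ∸ 10) (r + 22)) )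
theorem1p3 r _ = (lower-21 , part-a) , λ R[10,3]≤41 → lower-22 R[10,3]≤41 , part-b R[10,3]≤41
  where
  reassociate : ∀ r k → suc (suc r + k) ≡ r + suc (suc k)
  reassociate r k = sym (trans (+-suc r (suc k)) (cong suc (+-suc r k)))
  lower-21 : FvGe r (twos r) (r ∸ 10) (r + 21)
  -- Here `K` is 19, the last value covered by `gap-ramsey`, and `gap 19` is 11; `suc r + 19 < n`
  -- amounts to `r + 21 ≤ n`.
  lower-21 n G G∈Hv = subst (_≤ n) (reassociate r 19) (order-bound (from-yes (19 <? 21)) small-19 refl G∈Hv)
    where
    open Complement G
  lower-22 : RamseyLe 10 41 → FvGe r (twos r) (r ∸ 10) (r + 22)
  lower-22 R[10,3]≤41 n G G∈Hv =
    subst (_≤ n) (reassociate r 20) (order-bound (from-yes (20 <? 21)) (small-20 R[10,3]≤41) refl G∈Hv)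
    where
    open Complement G
  part-a : ¬ RamseyLe 10 41 → 20 ≤ r → FvEq r (twos r) (r ∸ 10) (r + 21)
  part-a R[10,3]>41 20≤r = lower-21 , construct (¬RamseyLe⇒graph R[10,3]>41)
    where
    construct : (Σ (Graph 41) λ G → ¬ HasClique G 10 × ¬ HasIndep G 3) →
      Σ (Graph (r + 21)) λ G → InHv G r (twos r) (r ∸ 10)
    -- The parameters are r₀ = 20, q₀ = 10 and c = 21.
    construct (G , ¬clique , ¬indep) = upper-bound G ¬clique ¬indep (from-yes (40 <? 41)) refl refl r 20≤r
  part-b : RamseyLe 10 41 → 21 ≤ r → FvEq r (twos r) (r ∸ 10) (r + 22)
  part-b R[10,3]≤41 21≤r = lower-22 R[10,3]≤41 ,
    -- The parameters are r₀ = 21, q₀ = 11 and c = 22.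
    upper-bound circulant circulant-clique circulant-indep (from-yes (42 <? 43)) refl refl r 21≤r
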